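{- Let $n$ be a positive integer. The cardinality $\eta_n$ of the set of all disjoint non-ordered pairs of $n^2\times n^2$ S-permutation matrices is equal to $$\eta_n=\frac{(n!)^{2n}}{2}\,\xi_n,$$ where $$\xi_n=(n!)^{2n}+\sum_{k=1}^{n^2}(-1)^k\left(\sum_{\overline{g}\in\overline{\mathfrak{G}}_{n,k}}|\overline{g}|\left(\prod_{i=0}^{n-2}\left[(n-i)!\right]^{\psi_i(\overline{g})}\right)\right).$$
   Context: A binary matrix is a matrix with all entries in $\{0,1\}$. An $n^2\times n^2$ matrix is divided by $n-1$ horizontal and $n-1$ vertical lines into $n^2$ non-intersecting $n\times n$ square sub-matrices $A_{kl}$, $1\le k,l\le n$, called blocks. An $n^2\times n^2$ binary matrix is an S-permutation matrix if each row, each column and each block contains exactly one $1$. Two binary matrices $A=(a_{ij})$ and $B=(b_{ij})$ of the same size are disjoint if there are no indices $i,j$ with $a_{ij}=b_{ij}=1$. For $0\le k\le n^2$, $\mathfrak{G}_{n,k}$ denotes the set of all bipartite graphs $g=\langle R_g\cup C_g,E_g\rangle$ without multiple edges on the fixed disjoint vertex sets $R_g=\{r_1,\dots,r_n\}$, $C_g=\{c_1,\dots,c_n\}$, with $E_g\subseteq R_g\times C_g$ and $|E_g|=k$. Two such graphs $g',g''$ are isomorphic, $g'\cong g''$, if there are bijections $\rho:R_{g'}\to R_{g''}$ and $\sigma:C_{g'}\to C_{g''}$ such that $\langle r,c\rangle\in E_{g'}\iff\langle\rho(r),\sigma(c)\rangle\in E_{g''}$ (in particular the two sides are not interchanged).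 $\overline{\mathfrak{G}}_{n,k}$ is the set of equivalence classes of $\mathfrak{G}_{n,k}$ under $\cong$; $\overline{g}=\{h\in\mathfrak{G}_{n,k} : h\cong g\}$ is the class of $g$ and $|\overline{g}|$ is its cardinality. For $i=0,1,\dots,n$, $\psi_i(g)$ is the number of vertices of $g$ (in $R_g\cup C_g$) incident to exactly $i$ edges; it depends only on the class, and $\psi_i(\overline{g})=\psi_i(g)$. An empty product equals $1$. -}

module Defs where

open import Data.Bool.Base using (Bool; true)
open import Data.Fin.Base using (Fin; toℕ; combine; finToFun; funToFin)
open import Data.Fin.Permutation as Perm
  using (Permutation′; _⟨$⟩ʳ_; _⟨$⟩ˡ_; inverseˡ; inverseʳ)
open import Data.Fin.Properties using (any?; all?; finToFun-funToFin)
  renaming (_≟_ to _≟ᶠ_)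
open import Data.Fin.Subset using (Subset; inside; outside; ∣_∣)
  renaming (_∈_ to _∈ˢ_)
open import Data.Fin.Subset.Properties using (_∈?_)
open import Data.Integer.Base as ℤ using (ℤ; +_; -1ℤ)
open import Data.Integer.Properties using (+-*-semiring)
open import Data.List.Base
  using (List; []; _∷_; _++_; map; filter; deduplicate; length; upTo)
open import Data.List.Membership.Propositional using (_∈_)
open import Data.List.Membership.Propositional.Properties
  using (∈-++⁺ˡ; ∈-++⁺ʳ; ∈-map⁺; ∈-map⁻; ∈-filter⁺; ∈-filter⁻)
open import Data.List.Relation.Unary.All using ([])
open import Data.List.Relation.Unary.AllPairs using (AllPairs; []; _∷_)
open import Data.List.Relation.Unary.Any as Any using (Any; here)
import Data.List.Relation.Unary.Any.Properties as Any
open import Data.List.Relation.Unary.Unique.DecSetoid.Properties using (deduplicate-!)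
open import Data.List.Relation.Unary.Unique.Propositional using (Unique)
import Data.List.Relation.Unary.Unique.Propositional.Properties as Unique
open import Data.Nat.Base using (ℕ; zero; suc; _+_; _*_; _∸_; _^_; _!)
open import Data.Nat.ListAction using (sum; product)
open import Data.Nat.Properties using (_≟_)
open import Data.Product using (∃!)
open import Data.Product.Base using (Σ-syntax; ∃; ∃₂; _×_; _,_; proj₁; proj₂)
open import Data.Sum.Base using (_⊎_; inj₁; inj₂)
open import Data.Vec.Base using (allFin; count; []; _∷_)
open import Data.Vec.Properties using (∷-injectiveʳ)
open import Function.Base using (_∘_)
open import Function.Bundles using (Bijection; _⇔_; mk⇔; mk↔ₛ′; Equivalence)
open import Level using (0ℓ)
open import Relation.Binary.Bundles using (Setoid; DecSetoid)
open import Relation.Binary.Definitions using (Decidable)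
open import Relation.Binary.PropositionalEquality
  using (_≡_; refl; sym; trans; cong; subst; subst₂; setoid)
open import Relation.Nullary.Decidable using (Dec; yes; no; map′; _×-dec_; _→-dec_)
open import Relation.Nullary.Negation using (¬_)

open import Algebra.Properties.Semiring.Sum +-*-semiring using (sum-syntax)

HasCardinality : Setoid 0ℓ 0ℓ → ℕ → Set
HasCardinality S m = Bijection (setoid (Fin m)) S

-- true is the entry 1, false the entry 0.
BinaryMatrix : ℕ → ℕ → Set
BinaryMatrix m n = Fin m → Fin n → Bool

infix 4 _≋_

_≋_ : ∀ {m n} → BinaryMatrix m n → BinaryMatrix m n → Set
A ≋ B = ∀ i j → A i j ≡ B i j

-- combine k i has value n * k + i, so block n A k l is the n × n submatrix A_{kl}.
block : ∀ n → BinaryMatrix (n * n) (n * n) → Fin n → Fin n → BinaryMatrix n n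
block n A k l i j = A (combine k i) (combine l j)

record IsSPermutation (n : ℕ) (A : BinaryMatrix (n * n) (n * n)) : Set where
  field
    row-one   : ∀ i → ∃! _≡_ λ j → A i j ≡ true
    col-one   : ∀ j → ∃! _≡_ λ i → A i j ≡ true
    block-one : ∀ k l → ∃! {A = Fin n × Fin n} _≡_
                  λ (i , j) → block n A k l i j ≡ true

Disjoint : ∀ {m n} → BinaryMatrix m n → BinaryMatrix m n → Set
Disjoint A B = ¬ ∃₂ λ i j → A i j ≡ true × B i j ≡ true

record DisjointPair (n : ℕ) : Set where
  field
    A B      : BinaryMatrix (n * n) (n * n)
    isA      : IsSPermutation n A
    isB      : IsSPermutation n B
    disjoint : Disjoint A B

infix 4 _≈ᵤ_

-- Equality of the non-ordered pairs {A, B} and {A′, B′}.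
_≈ᵤ_ : ∀ {n} → DisjointPair n → DisjointPair n → Set
p ≈ᵤ q = (p.A ≋ q.A × p.B ≋ q.B) ⊎ (p.A ≋ q.B × p.B ≋ q.A)
  where
  module p = DisjointPair p
  module q = DisjointPair q

≋-refl : ∀ {m n} {A : BinaryMatrix m n} → A ≋ A
≋-refl i j = refl

≋-sym : ∀ {m n} {A B : BinaryMatrix m n} → A ≋ B → B ≋ A
≋-sym A≋B i j = sym (A≋B i j)

≋-trans : ∀ {m n} {A B C : BinaryMatrix m n} → A ≋ B → B ≋ C → A ≋ C
≋-trans A≋B B≋C i j = trans (A≋B i j) (B≋C i j)

≈ᵤ-sym : ∀ {n} {p q : DisjointPair n} → p ≈ᵤ q → q ≈ᵤ p
≈ᵤ-sym (inj₁ (a , b)) = inj₁ (≋-sym a , ≋-sym b)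
≈ᵤ-sym (inj₂ (a , b)) = inj₂ (≋-sym b , ≋-sym a)

≈ᵤ-trans : ∀ {n} {p q r : DisjointPair n} → p ≈ᵤ q → q ≈ᵤ r → p ≈ᵤ r
≈ᵤ-trans (inj₁ (a , b)) (inj₁ (c , d)) = inj₁ (≋-trans a c , ≋-trans b d)
≈ᵤ-trans (inj₁ (a , b)) (inj₂ (c , d)) = inj₂ (≋-trans a c , ≋-trans b d)
≈ᵤ-trans (inj₂ (a , b)) (inj₁ (c , d)) = inj₂ (≋-trans a d , ≋-trans b c)
≈ᵤ-trans (inj₂ (a , b)) (inj₂ (c , d)) = inj₁ (≋-trans a d , ≋-trans b c)

DisjointPairs : ℕ → Setoid 0ℓ 0ℓ
DisjointPairs n = record
  { Carrier       = DisjointPair n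
  ; _≈_           = _≈ᵤ_
  ; isEquivalence = record
    { refl  = inj₁ (≋-refl , ≋-refl)
    ; sym   = λ {p} {q} → ≈ᵤ-sym {p = p} {q}
    ; trans = λ {p} {q} {r} → ≈ᵤ-trans {p = p} {q} {r}
    }
  }

-- Both vertex sets {r₁,…,rₙ} and {c₁,…,cₙ} are Fin n; the pair ⟨ r , c ⟩ is
-- coded by combine r c, which identifies R × C with Fin (n * n).
record BipartiteGraph (n : ℕ) : Set where
  constructor graph
  field
    edges : Subset (n * n)

open BipartiteGraph public

infix 4 ⟨_,_⟩∈_ ⟨_,_⟩∈?_ _≅_ _≅?_

⟨_,_⟩∈_ : ∀ {n} → Fin n → Fin n → BipartiteGraph n → Set
⟨ r , c ⟩∈ g = combine r c ∈ˢ edges g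

⟨_,_⟩∈?_ : ∀ {n} (r c : Fin n) (g : BipartiteGraph n) → Dec (⟨ r , c ⟩∈ g)
⟨ r , c ⟩∈? g = combine r c ∈? edges g

degreeᴿ : ∀ {n} → BipartiteGraph n → Fin n → ℕ
degreeᴿ {n} g r = count (λ c → ⟨ r , c ⟩∈? g) (allFin n)

degreeᶜ : ∀ {n} → BipartiteGraph n → Fin n → ℕ
degreeᶜ {n} g c = count (λ r → ⟨ r , c ⟩∈? g) (allFin n)

ψ : ∀ {n} → ℕ → BipartiteGraph n → ℕ
ψ {n} i g = count (λ r → degreeᴿ g r ≟ i) (allFin n)
          + count (λ c → degreeᶜ g c ≟ i) (allFin n)

_≅_ : ∀ {n} → BipartiteGraph n → BipartiteGraph n → Set
_≅_ {n} g h = Σ[ ρ ∈ Permutation′ n ] Σ[ σ ∈ Permutation′ n ]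
  (∀ r c → ⟨ r , c ⟩∈ g ⇔ ⟨ ρ ⟨$⟩ʳ r , σ ⟨$⟩ʳ c ⟩∈ h)

≅-refl : ∀ {n} {g : BipartiteGraph n} → g ≅ g
≅-refl = Perm.id , Perm.id , λ r c → mk⇔ (λ e → e) (λ e → e)

≅-sym : ∀ {n} {g h : BipartiteGraph n} → g ≅ h → h ≅ g
≅-sym {g = g} {h} (ρ , σ , iso) = Perm.flip ρ , Perm.flip σ , λ r c →
  let open Equivalence (iso (ρ ⟨$⟩ˡ r) (σ ⟨$⟩ˡ c)) in
  mk⇔ (λ e → from (subst₂ (⟨_,_⟩∈ h) (sym (inverseʳ ρ)) (sym (inverseʳ σ)) e))
      (λ e → subst₂ (⟨_,_⟩∈ h) (inverseʳ ρ) (inverseʳ σ) (to e))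

≅-trans : ∀ {n} {f g h : BipartiteGraph n} → f ≅ g → g ≅ h → f ≅ h
≅-trans (ρ , σ , iso) (ρ′ , σ′ , iso′) = ρ Perm.∘ₚ ρ′ , σ Perm.∘ₚ σ′ , λ r c →
  mk⇔ (Equivalence.to (iso′ _ _) ∘ Equivalence.to (iso r c))
      (Equivalence.from (iso r c) ∘ Equivalence.from (iso′ _ _))

-- A search over all permutations: a permutation is a pair of mutually inverse
-- functions, and finToFun enumerates the functions Fin n → Fin n.
anyPermutation? : ∀ {n} {P : Permutation′ n → Set} →
                  (∀ {π π′} → π Perm.≈ π′ → P π → P π′) →
                  (∀ π → Dec (P π)) → Dec (∃ P)
anyPermutation? {n} {P} resp P? =
  map′ (λ (x , y , i , j , p) → mk (decode x) (decode y) i j , p) encode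
    (any? λ x → any? λ y → good? x y)
  where
  decode : Fin (n ^ n) → Fin n → Fin n
  decode = finToFun

  code : (Fin n → Fin n) → Fin (n ^ n)
  code = funToFin

  Inv : (f g : Fin n → Fin n) → Set
  Inv f g = ∀ i → f (g i) ≡ i

  mk : ∀ f g → Inv f g → Inv g f → Permutation′ n
  mk f g = mk↔ₛ′ f g

  Good : Fin (n ^ n) → Fin (n ^ n) → Set
  Good x y = Σ[ i ∈ Inv (decode x) (decode y) ]
             Σ[ j ∈ Inv (decode y) (decode x) ] P (mk (decode x) (decode y) i j)

  good? : ∀ x y → Dec (Good x y)
  good? x y with all? (λ i → decode x (decode y i) ≟ᶠ i)
               | all? (λ i → decode y (decode x i) ≟ᶠ i)
  ... | no ¬i | _     = no (¬i ∘ proj₁)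
  ... | yes _ | no ¬j = no (λ (_ , j , _) → ¬j j)
  ... | yes i | yes j =
    map′ (λ p → i , j , p) (λ (_ , _ , p) → resp (λ _ → refl) p)
         (P? (mk (decode x) (decode y) i j))

  decode-code : ∀ f i → decode (code f) i ≡ f i
  decode-code = finToFun-funToFin

  encode : ∃ P → ∃ λ x → ∃ λ y → Good x y
  encode (π , p) = code (π ⟨$⟩ʳ_) , code (π ⟨$⟩ˡ_)
    , (λ i → trans (decode-code (π ⟨$⟩ʳ_) _)
               (trans (cong (π ⟨$⟩ʳ_) (decode-code (π ⟨$⟩ˡ_) i)) (inverseʳ π)))
    , (λ i → trans (decode-code (π ⟨$⟩ˡ_) _)
               (trans (cong (π ⟨$⟩ˡ_) (decode-code (π ⟨$⟩ʳ_) i)) (inverseˡ π)))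
    , resp (λ i → sym (decode-code (π ⟨$⟩ʳ_) i)) p

_≅?_ : ∀ {n} → Decidable (_≅_ {n})
g ≅? h =
  anyPermutation?
    (λ ρ≈ρ′ (σ , iso) → σ , λ r c →
      subst (λ x → ⟨ r , c ⟩∈ g ⇔ ⟨ x , σ ⟨$⟩ʳ c ⟩∈ h) (ρ≈ρ′ r) (iso r c))
    λ ρ → anyPermutation?
      (λ σ≈σ′ iso r c →
        subst (λ x → ⟨ r , c ⟩∈ g ⇔ ⟨ ρ ⟨$⟩ʳ r , x ⟩∈ h) (σ≈σ′ c) (iso r c))
      λ σ → all? λ r → all? λ c →
        (⟨ r , c ⟩∈? g) ⇔? (⟨ ρ ⟨$⟩ʳ r , σ ⟨$⟩ʳ c ⟩∈? h)
  where
  _⇔?_ : ∀ {P Q : Set} → Dec P → Dec Q → Dec (P ⇔ Q)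
  P? ⇔? Q? = map′ (λ (f , g) → mk⇔ f g)
                  (λ e → Equivalence.to e , Equivalence.from e)
                  ((P? →-dec Q?) ×-dec (Q? →-dec P?))

≅-decSetoid : ℕ → DecSetoid 0ℓ 0ℓ
≅-decSetoid n = record
  { Carrier          = BipartiteGraph n
  ; _≈_              = _≅_
  ; isDecEquivalence = record
    { isEquivalence = record
      { refl  = ≅-refl
      ; sym   = λ {g} {h} → ≅-sym {g = g} {h}
      ; trans = λ {f} {g} {h} → ≅-trans {f = f} {g} {h}
      }
    ; _≟_           = _≅?_
    }
  }

subsets : ∀ n → List (Subset n)
subsets zero    = [] ∷ []
subsets (suc n) = map (outside ∷_) (subsets n) ++ map (inside ∷_) (subsets n)

∈-subsets : ∀ {n} (p : Subset n) → p ∈ subsets n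
∈-subsets []            = here refl
∈-subsets (outside ∷ p) = ∈-++⁺ˡ (∈-map⁺ (outside ∷_) (∈-subsets p))
∈-subsets {suc n} (inside ∷ p)  =
  ∈-++⁺ʳ (map (outside ∷_) (subsets n)) (∈-map⁺ (inside ∷_) (∈-subsets p))

subsets-unique : ∀ n → Unique (subsets n)
subsets-unique zero    = [] ∷ []
subsets-unique (suc n) = Unique.++⁺
  (Unique.map⁺ ∷-injectiveʳ (subsets-unique n))
  (Unique.map⁺ ∷-injectiveʳ (subsets-unique n))
  λ (p , q) → disj (∈-map⁻ (outside ∷_) p) (∈-map⁻ (inside ∷_) q)
  where
  disj : ∀ {v : Subset (suc n)} →
         (∃ λ x → x ∈ subsets n × v ≡ outside ∷ x) →
         ¬ (∃ λ y → y ∈ subsets n × v ≡ inside ∷ y)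
  disj (_ , _ , refl) (_ , _ , ())

𝔊 : ∀ n → ℕ → List (BipartiteGraph n)
𝔊 n k = map graph (filter (λ E → ∣ E ∣ ≟ k) (subsets (n * n)))

∈-𝔊 : ∀ {n k} (g : BipartiteGraph n) → g ∈ 𝔊 n k ⇔ ∣ edges g ∣ ≡ k
∈-𝔊 {n} {k} g = mk⇔
  (λ g∈ → to (∈-map⁻ graph g∈))
  (λ eq → ∈-map⁺ graph (∈-filter⁺ size? (∈-subsets (edges g)) eq))
  where
  size? : ∀ (E : Subset (n * n)) → Dec (∣ E ∣ ≡ k)
  size? E = ∣ E ∣ ≟ k

  to : (∃ λ E → E ∈ filter size? (subsets (n * n)) × g ≡ graph E) →
       ∣ edges g ∣ ≡ k
  to (_ , E∈ , refl) = proj₂ (∈-filter⁻ size? {xs = subsets (n * n)} E∈)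

𝔊-unique : ∀ n k → Unique (𝔊 n k)
𝔊-unique n k = Unique.map⁺ (cong edges)
  (Unique.filter⁺ (λ E → ∣ E ∣ ≟ k) (subsets-unique (n * n)))

-- The quotient of 𝔊 n k by _≅_, given by one representative for each class.
𝔊/≅ : ∀ n → ℕ → List (BipartiteGraph n)
𝔊/≅ n k = deduplicate _≅?_ (𝔊 n k)

𝔊/≅-complete : ∀ {n k} {g : BipartiteGraph n} →
               g ∈ 𝔊 n k → Any (g ≅_) (𝔊/≅ n k)
𝔊/≅-complete {g = g} g∈ =
  Any.deduplicate⁺ _≅?_ (λ {x} {y} y≅x g≅x →
      ≅-trans {f = g} {x} {y} g≅x (≅-sym {g = y} {x} y≅x))
    (Any.map (λ { refl → ≅-refl {g = g} }) g∈)

𝔊/≅-distinct : ∀ n k → AllPairs (λ g h → ¬ g ≅ h) (𝔊/≅ n k)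
𝔊/≅-distinct n k = deduplicate-! (≅-decSetoid n) (𝔊 n k)

isoClass : ∀ {n} → ℕ → BipartiteGraph n → List (BipartiteGraph n)
isoClass {n} k g = filter (_≅? g) (𝔊 n k)

-- upTo (n ∸ 1) is 0, …, n - 2, empty for n = 1.
weight : ∀ {n} → BipartiteGraph n → ℕ
weight {n} g = product (map (λ i → ((n ∸ i) !) ^ ψ i g) (upTo (n ∸ 1)))

classSum : ℕ → ℕ → ℕ
classSum n k = sum (map (λ g → length (isoClass k g) * weight g) (𝔊/≅ n k))

-- i : Fin (n * n) stands for the index k = i + 1 in 1 ≤ k ≤ n².
ξ : ℕ → ℤ
ξ n = + ((n !) ^ (2 * n))
  ℤ.+ (∑[ i < n * n ] (-1ℤ ℤ.^ suc (toℕ i) ℤ.* + classSum n (suc (toℕ i))))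

{-# OPTIONS --safe #-}
-- An S-permutation matrix is the same thing as n permutations ρ_k (one for each
-- row of blocks) and n permutations σ_l (one for each column of blocks): block
-- (k , l) has its 1 in position (ρ_k(l) , σ_l(k)).  Hence there are (n!)^(2n) of
-- them, and two of them are disjoint iff there is no block (k , l) in which
-- both ρ_k(l) = ρ′_k(l) and σ_l(k) = σ′_l(k).
-- For a fixed first matrix, the second matrices that agree with it in every block
-- of a set E number ∏_v (n − deg v)!, the product over the vertices of the
-- bipartite graph E, so by inclusion–exclusion ξ_n of them agree nowhere.
module Submission where

open import Defs
import Algebra.Properties.CommutativeMonoid.Sum as CommutativeMonoidSum
import Algebra.Properties.Semiring.Sum as SemiringSum
open import Data.Bool.Base using (true; false; if_then_else_)
open import Data.Bool.Properties using (⇔→≡)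
open import Data.Fin.Base as Fin
  using (Fin; zero; suc; toℕ; punchIn; punchOut; combine; remQuot; quotient; remainder; _↑ˡ_; _↑ʳ_)
open import Data.Fin.Permutation as Perm
  using (Permutation′; permutation; _⟨$⟩ʳ_; _⟨$⟩ˡ_; inverseˡ; inverseʳ; insert; remove
        ; insert-punchIn; insert-remove; remove-insert; punchIn-permute; ↔⇒≡)
open import Data.Fin.Properties
  using (any?; all?; suc-injective; punchIn-injective; punchIn-punchOut
        ; *↔×; remQuot-combine; combine-remQuot; _<?_; <-cmp; <-asym; <-irrefl)
  renaming (_≟_ to _≟ᶠ_)
open import Data.Fin.Subset using (Subset; inside; outside; ∣_∣; ⊥) renaming (_∈_ to _∈ˢ_)
open import Data.Fin.Subset.Properties using (_∈?_; ∣p∣≤n; ∉⊥)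
open import Data.Integer.Base as ℤ using (ℤ; +_; -1ℤ)
import Data.Integer.Properties as ℤ
open import Data.List.Base using (List; []; _∷_; _++_; map; filter; length; upTo; applyUpTo)
open import Data.List.Properties using (filter-++; filter-none; map-upTo; map-∘; map-cong)
open import Data.List.Relation.Unary.All as All using (All; []; _∷_)
open import Data.List.Relation.Unary.AllPairs as AllPairs using (AllPairs; []; _∷_)
open import Data.List.Relation.Unary.Any using (Any; here; there)
open import Data.Nat.Base
  using (ℕ; zero; suc; _+_; _*_; _^_; _∸_; _!; _≤_; _<_; z≤n; s≤s; z<s; s<s; NonZero)
open import Data.Nat.ListAction using (sum; product)
open import Data.Nat.Properties
  using (_≟_; +-*-semiring; *-1-commutativeMonoid; +-commutativeSemigroup; +-assoc; +-comm
        ; +-identityʳ; *-identityˡ; *-identityʳ; *-distribʳ-+; ^-distribˡ-+-*; ^-identityʳ; ^-zeroˡ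
        ; m≤n+o⇒m∸n≤o; m≤n+m∸n; ≤-trans; ≤-reflexive)
open import Algebra.Properties.CommutativeSemigroup +-commutativeSemigroup using (interchange)
open import Data.Product.Base using (Σ; ∃; ∃-syntax; _×_; _,_; proj₁; proj₂; uncurry)
open import Data.Product.Function.NonDependent.Setoid using (_×-inverse_)
open import Data.Product.Relation.Binary.Pointwise.NonDependent using (_×ₛ_; Pointwise-≡↔≡)
open import Data.Rational.Base as ℚ using (_/_; toℚᵘ)
import Data.Rational.Properties as ℚ
import Data.Rational.Unnormalised.Base as ℚᵘ
import Data.Rational.Unnormalised.Properties as ℚᵘ
open import Data.Sum.Base using (inj₁; inj₂)
open import Data.Vec.Base using ([]; _∷_; count; allFin; tabulate; here; there)
open import Function.Base using (_∘_; id)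
open import Function.Bundles using (Inverse; Bijection; Equivalence; mk⇔)
import Function.Properties.Bijection as Bij
import Function.Properties.Inverse as Inv
open import Level using (0ℓ)
open import Relation.Binary.Bundles using (Setoid)
import Relation.Binary.Construct.On as On
import Relation.Binary.Definitions as Binary
open import Relation.Binary.Definitions using (tri<; tri≈; tri>)
open import Relation.Binary.PropositionalEquality
open import Relation.Nullary.Decidable
  using (Dec; yes; no; does; dec-true; dec-false; ¬?; _×-dec_; _→-dec_)
open import Relation.Nullary.Negation using (¬_; contradiction)
open import Relation.Unary using (Decidable)

-- The three uniqueness conditions share the work: the one for blocks gives ρ_k and σ_l as
-- functions, the one for rows supplies the inverse of ρ_k, the one for columns that of σ_l. An edge
-- ⟨k , l⟩ of E restricts only ρ_k at l and σ_l at k, so the constraints separate by vertex, and a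
-- permutation prescribed by another one at d places leaves (n - d)! choices. The number ξ_n of
-- partners is the same for every first matrix, which gives (n!)^(2n) · ξ_n ordered pairs; for n > 0
-- no matrix is disjoint from itself, so each non-ordered pair is counted exactly twice. The stated
-- ξ_n departs from the alternating sum over edge sets in three ways: the empty set is a separate
-- leading term, graphs are collected by isomorphism class, and vertices by degree, where degrees n
-- - 1 and n are left out because their factors are 1! and 0!. Matrices and permutations are
-- functions compared pointwise, so cardinalities are those of setoids; sets are counted in two ways
-- and `Card-unique` equates the results.

module Σℕ = SemiringSum +-*-semiring
module Σℤ = SemiringSum ℤ.+-*-semiring
module Πℕ = CommutativeMonoidSum *-1-commutativeMonoid

-- Finite products, indicators and sums

∏ : ∀ {n} → (Fin n → ℕ) → ℕ
∏ = Πℕ.sum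

∏-const : ∀ n c → ∏ {n} (λ _ → c) ≡ c ^ n
∏-const zero    c = refl
∏-const (suc n) c = cong (c *_) (∏-const n c)

∏-const-squared : ∀ n c → ∏ {n} (λ _ → c) * ∏ {n} (λ _ → c) ≡ c ^ (2 * n)
∏-const-squared n c = trans (cong₂ _*_ (∏-const n c) (∏-const n c))
  (trans (sym (^-distribˡ-+-* c n n)) (cong (λ k → c ^ (n + k)) (sym (+-identityʳ n))))

∏-cong : ∀ {n} {f g : Fin n → ℕ} → f ≗ g → ∏ f ≡ ∏ g
∏-cong = Πℕ.sum-cong-≗

𝟙 : ∀ {P : Set} → Dec P → ℕ
𝟙 P? = if does P? then 1 else 0

𝟙-yes : ∀ {P : Set} (P? : Dec P) → P → 𝟙 P? ≡ 1
𝟙-yes P? p = cong (if_then 1 else 0) (dec-true P? p)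

𝟙-no : ∀ {P : Set} (P? : Dec P) → ¬ P → 𝟙 P? ≡ 0
𝟙-no P? ¬p = cong (if_then 1 else 0) (dec-false P? ¬p)

𝟙-cong : ∀ {P Q : Set} (P? : Dec P) (Q? : Dec Q) → (P → Q) → (Q → P) → 𝟙 P? ≡ 𝟙 Q?
𝟙-cong (yes p) Q? f g = sym (𝟙-yes Q? (f p))
𝟙-cong (no ¬p) Q? f g = sym (𝟙-no Q? (¬p ∘ g))

+-∑ : ∀ {n} (f : Fin n → ℕ) → Σℤ.sum (λ i → + f i) ≡ + Σℕ.sum f
+-∑ {zero}  f = refl
+-∑ {suc n} f = cong (ℤ._+_ (+ f zero)) (+-∑ (f ∘ suc))

∑-↑ : ∀ m {n} (f : Fin (m + n) → ℕ) →
      Σℕ.sum f ≡ Σℕ.sum (λ i → f (i ↑ˡ n)) + Σℕ.sum (λ j → f (m ↑ʳ j))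
∑-↑ zero    f = refl
∑-↑ (suc m) f = trans (cong₂ _+_ refl (∑-↑ m (f ∘ suc))) (sym (+-assoc (f zero) _ _))

∑-combine : ∀ m {n} (f : Fin (m * n) → ℕ) →
            Σℕ.sum f ≡ Σℕ.sum (λ (i : Fin m) → Σℕ.sum λ (j : Fin n) → f (combine i j))
∑-combine zero        f = refl
∑-combine (suc m) {n} f = trans (∑-↑ n f) (cong₂ _+_ refl (∑-combine m (λ x → f (n ↑ʳ x))))

-- Cardinality of finite setoids

-- An `Inverse` instead of the `Bijection` of `HasCardinality`, because it is easily reversed and
-- multiplied componentwise; the conversion is made once, for the final count.
Card : Setoid 0ℓ 0ℓ → ℕ → Set
Card S m = Inverse (setoid (Fin m)) S

Card-unique : ∀ {S m n} → Card S m → Card S n → m ≡ n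
Card-unique I J = ↔⇒≡ (Inv.trans I (Inv.sym J))

Card-resp : ∀ {S T m} → Inverse S T → Card S m → Card T m
Card-resp I J = Inv.trans J I

Card-× : ∀ {S T m n} → Card S m → Card T n → Card (S ×ₛ T) (m * n)
Card-× I J = Inv.trans (Inv.trans *↔× (Inv.sym Pointwise-≡↔≡)) (I ×-inverse J)

infix 4 _∣ˢ_

-- Equality looks at the first components only, so different proofs of `P` do not produce different
-- elements.
_∣ˢ_ : (S : Setoid 0ℓ 0ℓ) → (Setoid.Carrier S → Set) → Setoid 0ℓ 0ℓ
S ∣ˢ P = On.setoid {B = Σ (Setoid.Carrier S) P} S proj₁

∣ˢ-inverse : ∀ {S T} (I : Inverse S T) {P : Setoid.Carrier S → Set} {Q : Setoid.Carrier T → Set} →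
             (∀ {s} → P s → Q (Inverse.to I s)) → (∀ {t} → Q t → P (Inverse.from I t)) →
             Inverse (S ∣ˢ P) (T ∣ˢ Q)
∣ˢ-inverse I f g = record
  { to        = λ (s , p) → to s , f p
  ; from      = λ (t , q) → from t , g q
  ; to-cong   = to-cong
  ; from-cong = from-cong
  ; inverse   = Inverse.inverseˡ I , Inverse.inverseʳ I
  }
  where open Inverse I using (to; from; to-cong; from-cong)

∏ˢ : ∀ {n} → (Fin n → Setoid 0ℓ 0ℓ) → Setoid 0ℓ 0ℓ
∏ˢ S = record
  { Carrier       = ∀ i → S.Carrier i
  ; _≈_           = λ f g → ∀ i → S._≈_ i (f i) (g i)
  ; isEquivalence = record
    { refl  = λ i → S.refl i
    ; sym   = λ p i → S.sym i (p i)
    ; trans = λ p q i → S.trans i (p i) (q i)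
    }
  }
  where module S i = Setoid (S i)

∏ˢ-suc : ∀ {n} (S : Fin (suc n) → Setoid 0ℓ 0ℓ) → Inverse (S zero ×ₛ ∏ˢ (S ∘ suc)) (∏ˢ S)
∏ˢ-suc S = record
  { to        = λ (x , f) → λ { zero → x ; (suc i) → f i }
  ; from      = λ f → f zero , f ∘ suc
  ; to-cong   = λ (p , q) → λ { zero → p ; (suc i) → q i }
  ; from-cong = λ p → p zero , p ∘ suc
  ; inverse   = (λ (p , q) → λ { zero → p ; (suc i) → q i }) , λ p → p zero , p ∘ suc
  }

Card-∏ : ∀ {n} {S : Fin n → Setoid 0ℓ 0ℓ} {f : Fin n → ℕ} →
         (∀ i → Card (S i) (f i)) → Card (∏ˢ S) (∏ f)
Card-∏ {zero} c = record
  { to        = λ _ ()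
  ; from      = λ _ → zero
  ; to-cong   = λ _ ()
  ; from-cong = λ _ → refl
  ; inverse   = (λ _ ()) , λ { {zero} _ → refl }
  }
Card-∏ {suc n} {S} c = Card-resp (∏ˢ-suc S) (Card-× (c zero) (Card-∏ (c ∘ suc)))

-- Links cardinalities to sums of indicators, on which summations can be exchanged. The recursion
-- follows that of the sum: `zero` either takes the first index or is skipped.
Card-filter : ∀ {n} {P : Fin n → Set} (P? : Decidable P) →
              Card (setoid (Fin n) ∣ˢ P) (Σℕ.sum (𝟙 ∘ P?))
Card-filter {zero} P? = record
  { to        = λ ()
  ; from      = λ ()
  ; to-cong   = λ { {()} }
  ; from-cong = λ { {() , _} }
  ; inverse   = (λ { {() , _} }) , λ { {()} }
  }
Card-filter {suc n} {P} P? with P? zero | Card-filter (P? ∘ suc)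
... | no ¬p | I = Bij.Bijection⇒Inverse record
  { to        = λ i → let (j , q) = to i in suc j , q
  ; cong      = cong suc ∘ to-cong
  ; bijective = injective ∘ suc-injective , surj
  }
  where
  open Inverse I using (to; from; to-cong; strictlyInverseˡ)
  open Bijection (Inv.Inverse⇒Bijection I) using (injective)
  surj : ∀ y → _
  surj (zero , p)  = contradiction p ¬p
  surj (suc j , p) = from (j , p) , λ { refl → cong suc (strictlyInverseˡ (j , p)) }
... | yes p₀ | I = Bij.Bijection⇒Inverse record
  { to        = to′
  ; cong      = λ { refl → refl }
  ; bijective = (λ {x} {y} → inj x y) , surj
  }
  where
  open Inverse I using (to; from; strictlyInverseˡ)
  open Bijection (Inv.Inverse⇒Bijection I) using (injective)
  to′ : Fin (suc _) → Σ (Fin (suc n)) P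
  to′ zero    = zero , p₀
  to′ (suc i) = let (j , q) = to i in suc j , q
  inj : ∀ x y → proj₁ (to′ x) ≡ proj₁ (to′ y) → x ≡ y
  inj zero    zero    _  = refl
  inj zero    (suc y) ()
  inj (suc x) zero    ()
  inj (suc x) (suc y) eq = cong suc (injective (suc-injective eq))
  surj : ∀ y → _
  surj (zero , p)  = zero , λ { refl → refl }
  surj (suc j , p) = suc (from (j , p)) , λ { refl → cong suc (strictlyInverseˡ (j , p)) }

count-tabulate : ∀ {A : Set} {P : A → Set} (P? : Decidable P) {n} (f : Fin n → A) →
                 count P? (tabulate f) ≡ Σℕ.sum (𝟙 ∘ P? ∘ f)
count-tabulate P? {zero}  f = refl
count-tabulate P? {suc n} f with does (P? (f zero))
... | true  = cong suc (count-tabulate P? (f ∘ suc))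
... | false = count-tabulate P? (f ∘ suc)

count-∑ : ∀ {n} {P : Fin n → Set} (P? : Decidable P) → count P? (allFin n) ≡ Σℕ.sum (𝟙 ∘ P?)
count-∑ P? = count-tabulate P? id

-- Permutations with prescribed values

Permutations : ℕ → Setoid 0ℓ 0ℓ
Permutations n = record
  { Carrier       = Permutation′ n
  ; _≈_           = Perm._≈_
  ; isEquivalence = record
    { refl  = λ _ → refl
    ; sym   = λ p i → sym (p i)
    ; trans = λ p q i → trans (p i) (q i)
    }
  }

module _ {n : ℕ} (i : Fin (suc n)) where

  insert-here : ∀ j (π : Permutation′ n) → insert i j π ⟨$⟩ʳ i ≡ j
  insert-here j π with i ≟ᶠ i
  ... | yes _   = refl
  ... | no  i≢i = contradiction refl i≢i

  remove-unique : ∀ {j} (π : Permutation′ (suc n)) (ρ : Permutation′ n) → π ⟨$⟩ʳ i ≡ j →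
                  (∀ k → π ⟨$⟩ʳ punchIn i k ≡ punchIn j (ρ ⟨$⟩ʳ k)) → remove i π Perm.≈ ρ
  remove-unique π ρ refl eq k =
    punchIn-injective (π ⟨$⟩ʳ i) _ _ (trans (sym (punchIn-permute π i k)) (eq k))

  ≈-punchIn : ∀ {π ρ : Permutation′ (suc n)} → π ⟨$⟩ʳ i ≡ ρ ⟨$⟩ʳ i →
              (∀ k → π ⟨$⟩ʳ punchIn i k ≡ ρ ⟨$⟩ʳ punchIn i k) → π Perm.≈ ρ
  ≈-punchIn {π} {ρ} at-i off-i j with i ≟ᶠ j
  ... | yes refl = at-i
  ... | no  i≢j  = subst (λ k → π ⟨$⟩ʳ k ≡ ρ ⟨$⟩ʳ k) (punchIn-punchOut i≢j) (off-i (punchOut i≢j))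

  insert-cong : ∀ j {π ρ : Permutation′ n} → π Perm.≈ ρ → insert i j π Perm.≈ insert i j ρ
  insert-cong j {π} {ρ} π≈ρ = ≈-punchIn {insert i j π} {insert i j ρ}
    (trans (insert-here j π) (sym (insert-here j ρ)))
    λ k → trans (insert-punchIn i j π k)
            (trans (cong (punchIn j) (π≈ρ k)) (sym (insert-punchIn i j ρ k)))

  remove-cong : {π ρ : Permutation′ (suc n)} → π Perm.≈ ρ → remove i π Perm.≈ remove i ρ
  remove-cong {π} {ρ} π≈ρ = remove-unique π (remove i ρ) (π≈ρ i)
    λ k → trans (π≈ρ _) (punchIn-permute ρ i k)

  -- The recursion (n+1)! = (n+1) · n!: a permutation is its value at `i` together with what remains
  -- after deleting `i` and its image.
  insert-inverse : Inverse (setoid (Fin (suc n)) ×ₛ Permutations n) (Permutations (suc n))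
  insert-inverse = record
    { to        = λ (j , π) → insert i j π
    ; from      = λ π → π ⟨$⟩ʳ i , remove i π
    ; to-cong   = λ { {j , π} {_ , ρ} (refl , π≈ρ) → insert-cong j {π} {ρ} π≈ρ }
    ; from-cong = λ {π} {ρ} π≈ρ → π≈ρ i , remove-cong {π} {ρ} π≈ρ
    ; inverse   = (λ { {π} {_ , ρ} (refl , ρ≈) k →
                       trans (insert-cong (π ⟨$⟩ʳ i) {ρ} {remove i π} ρ≈ k) (insert-remove i π k) })
                , λ { {j , π} {ρ} ρ≈ → trans (ρ≈ i) (insert-here j π)
                    , λ k → trans (remove-cong {ρ} {insert i j π} ρ≈ k) (remove-insert i j π k) }
    }

Card-Permutations : ∀ n → Card (Permutations n) (n !)
Card-Permutations zero = record
  { to        = λ _ → Perm.id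
  ; from      = λ _ → zero
  ; to-cong   = λ _ ()
  ; from-cong = λ _ → refl
  ; inverse   = (λ _ ()) , λ { {zero} _ → refl }
  }
Card-Permutations (suc n) =
  Card-resp (insert-inverse zero) (Card-× (Inv.refl (setoid _)) (Card-Permutations n))

Agreeing : ∀ {n} → Permutation′ n → (Fin n → Set) → Setoid 0ℓ 0ℓ
Agreeing {n} π P = Permutations n ∣ˢ (λ σ → ∀ i → P i → π ⟨$⟩ʳ i ≡ σ ⟨$⟩ʳ i)

-- At a place `i` of `P` the value is forced to be that of `π`, so deleting `i` loses no
-- information. Both permutations lose the same image, hence agreement at the other places survives
-- in both directions.
Agreeing-remove : ∀ {n} (π : Permutation′ (suc n)) {P : Fin (suc n) → Set} i → P i →
                  Inverse (Agreeing (remove i π) (P ∘ punchIn i)) (Agreeing π P)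
Agreeing-remove {n} π {P} i pᵢ = record
  { to        = λ (σ , agree) → insert i (π ⟨$⟩ʳ i) σ , extend σ agree
  ; from      = λ (σ , agree) → remove i σ , λ k p → restrict σ agree k p
  ; to-cong   = λ { {σ , _} {τ , _} → insert-cong i (π ⟨$⟩ʳ i) {σ} {τ} }
  ; from-cong = λ { {σ , _} {τ , _} → remove-cong i {σ} {τ} }
  ; inverse   = (λ { {σ , agree} {τ , _} τ≈ k →
                     trans (insert-cong i (π ⟨$⟩ʳ i) {τ} {remove i σ} τ≈ k)
                       (trans (cong (λ j → insert i j (remove i σ) ⟨$⟩ʳ k) (agree i pᵢ))
                         (insert-remove i σ k)) })
              , λ { {σ , _} {τ , _} τ≈ k →
                    trans (remove-cong i {τ} {insert i (π ⟨$⟩ʳ i) σ} τ≈ k)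
                      (remove-insert i (π ⟨$⟩ʳ i) σ k) }
  }
  where
  restrict : ∀ σ → (∀ j → P j → π ⟨$⟩ʳ j ≡ σ ⟨$⟩ʳ j) →
             ∀ k → P (punchIn i k) → remove i π ⟨$⟩ʳ k ≡ remove i σ ⟨$⟩ʳ k
  restrict σ agree k p = punchIn-injective (π ⟨$⟩ʳ i) _ _
    (trans (sym (punchIn-permute π i k))
      (trans (agree _ p)
        (trans (punchIn-permute σ i k)
          (cong (λ j → punchIn j (remove i σ ⟨$⟩ʳ k)) (sym (agree i pᵢ))))))

  extend : ∀ σ → (∀ k → P (punchIn i k) → remove i π ⟨$⟩ʳ k ≡ σ ⟨$⟩ʳ k) →
           ∀ j → P j → π ⟨$⟩ʳ j ≡ insert i (π ⟨$⟩ʳ i) σ ⟨$⟩ʳ j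
  extend σ agree j p with i ≟ᶠ j
  ... | yes refl = refl
  ... | no  i≢j  = trans (cong (π ⟨$⟩ʳ_) (sym (punchIn-punchOut i≢j)))
    (trans (punchIn-permute π i _)
      (cong (punchIn (π ⟨$⟩ʳ i)) (agree _ (subst P (sym (punchIn-punchOut i≢j)) p))))

-- Deleting a prescribed place lowers both `n` and the number of prescribed places by one and leaves
-- their difference unchanged; with no place left, all permutations qualify. The recursion uses a
-- sum of indicators in place of `count`, since `sum-remove` can split off an arbitrary index.
Card-Agreeing : ∀ {n} (π : Permutation′ n) {P : Fin n → Set} (P? : Decidable P) →
                Card (Agreeing π P) ((n ∸ count P? (allFin n)) !)
Card-Agreeing {n} π {P} P? = subst (λ c → Card (Agreeing π P) ((n ∸ c) !)) (sym (count-∑ P?)) (go π P?)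
  where
  go : ∀ {n} (π : Permutation′ n) {P : Fin n → Set} (P? : Decidable P) →
       Card (Agreeing π P) ((n ∸ Σℕ.sum (𝟙 ∘ P?)) !)
  unconstrained : ∀ {n} (π : Permutation′ n) {P : Fin n → Set} (P? : Decidable P) →
                  (∀ i → ¬ P i) → Card (Agreeing π P) ((n ∸ Σℕ.sum (𝟙 ∘ P?)) !)
  unconstrained {n} π {P} P? ¬P =
    subst (λ c → Card (Agreeing π P) ((n ∸ c) !)) (sym ∑≡0)
      (Card-resp all-agree (Card-Permutations n))
    where
    ∑≡0 : Σℕ.sum (𝟙 ∘ P?) ≡ 0
    ∑≡0 = trans (Σℕ.sum-cong-≗ (λ i → 𝟙-no (P? i) (¬P i))) (Σℕ.sum-replicate-zero n)
    all-agree : Inverse (Permutations n) (Agreeing π P)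
    all-agree = record
      { to        = λ σ → σ , λ i p → contradiction p (¬P i)
      ; from      = proj₁
      ; to-cong   = id
      ; from-cong = id
      ; inverse   = id , id
      }

  go {zero}  π P? = unconstrained π P? λ ()
  go {suc n} π {P} P? with any? P?
  ... | no  ∄P       = unconstrained π P? λ i p → ∄P (i , p)
  ... | yes (i , pᵢ) = subst (λ c → Card (Agreeing π P) ((suc n ∸ c) !)) (sym ∑≡suc)
    (Card-resp (Agreeing-remove π i pᵢ) (go (remove i π) (P? ∘ punchIn i)))
    where
    ∑≡suc : Σℕ.sum (𝟙 ∘ P?) ≡ suc (Σℕ.sum (𝟙 ∘ P? ∘ punchIn i))
    ∑≡suc = trans (Σℕ.sum-remove {i = i} (𝟙 ∘ P?)) (cong (_+ Σℕ.sum (𝟙 ∘ P? ∘ punchIn i)) (𝟙-yes (P? i) pᵢ))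

-- Inclusion–exclusion

∑ˡ : ∀ {A : Set} → List A → (A → ℤ) → ℤ
∑ˡ []       f = + 0
∑ˡ (x ∷ xs) f = f x ℤ.+ ∑ˡ xs f

∑ˡ-cong : ∀ {A : Set} (xs : List A) {f g : A → ℤ} → f ≗ g → ∑ˡ xs f ≡ ∑ˡ xs g
∑ˡ-cong []       eq = refl
∑ˡ-cong (x ∷ xs) eq = cong₂ ℤ._+_ (eq x) (∑ˡ-cong xs eq)

∑ˡ-++ : ∀ {A : Set} (xs ys : List A) f → ∑ˡ (xs ++ ys) f ≡ ∑ˡ xs f ℤ.+ ∑ˡ ys f
∑ˡ-++ []       ys f = sym (ℤ.+-identityˡ _)
∑ˡ-++ (x ∷ xs) ys f = trans (cong (ℤ._+_ (f x)) (∑ˡ-++ xs ys f)) (sym (ℤ.+-assoc (f x) _ _))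

∑ˡ-map : ∀ {A B : Set} (h : A → B) xs f → ∑ˡ (map h xs) f ≡ ∑ˡ xs (f ∘ h)
∑ˡ-map h []       f = refl
∑ˡ-map h (x ∷ xs) f = cong (ℤ._+_ (f (h x))) (∑ˡ-map h xs f)

∑ˡ-zero : ∀ {A : Set} (xs : List A) → ∑ˡ xs (λ _ → + 0) ≡ + 0
∑ˡ-zero []       = refl
∑ˡ-zero (x ∷ xs) = trans (ℤ.+-identityˡ _) (∑ˡ-zero xs)

∑ˡ-neg : ∀ {A : Set} (xs : List A) f → ∑ˡ xs (λ x → ℤ.- f x) ≡ ℤ.- ∑ˡ xs f
∑ˡ-neg []       f = refl
∑ˡ-neg (x ∷ xs) f = trans (cong (ℤ._+_ (ℤ.- f x)) (∑ˡ-neg xs f)) (sym (ℤ.neg-distrib-+ (f x) _))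

∑-∑ˡ-comm : ∀ {A : Set} {n} (xs : List A) (f : Fin n → A → ℤ) →
            Σℤ.sum (λ i → ∑ˡ xs (f i)) ≡ ∑ˡ xs (λ x → Σℤ.sum λ i → f i x)
∑-∑ˡ-comm {n = n} []       f = Σℤ.sum-replicate-zero n
∑-∑ˡ-comm {n = n} (x ∷ xs) f =
  trans (Σℤ.∑-distrib-+ {n} (λ i → f i x) _) (cong (ℤ._+_ (Σℤ.sum λ i → f i x)) (∑-∑ˡ-comm xs f))

sign : ℕ → ℤ
sign k = -1ℤ ℤ.^ k

allIn? : ∀ {m} {P : Fin m → Set} → Decidable P → (E : Subset m) → Dec (∀ e → e ∈ˢ E → P e)
allIn? P? E = all? λ e → (e ∈? E) →-dec P? e

-- When P zero holds, the subsets containing zero cancel the others; when it fails, they contribute 0.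
∑-subsets : ∀ {m} {P : Fin m → Set} (P? : Decidable P) →
            ∑ˡ (subsets m) (λ E → sign ∣ E ∣ ℤ.* + 𝟙 (allIn? P? E)) ≡ + 𝟙 (all? (¬? ∘ P?))
∑-subsets {zero}  P? = refl
∑-subsets {suc m} {P} P? = trans (∑ˡ-++ (map (outside ∷_) (subsets m)) _ _)
  (trans (cong₂ ℤ._+_ ∑-without-zero
           (trans (∑ˡ-map (inside ∷_) (subsets m) _) (∑-with-zero (P? zero))))
    (total (P? zero)))
  where
  ih = ∑-subsets (P? ∘ suc)
  tail = 𝟙 (all? (¬? ∘ P? ∘ suc))
  term : Subset m → ℤ
  term E = sign ∣ E ∣ ℤ.* + 𝟙 (allIn? (P? ∘ suc) E)

  ∑-without-zero : ∑ˡ (map (outside ∷_) (subsets m)) (λ E → sign ∣ E ∣ ℤ.* + 𝟙 (allIn? P? E)) ≡ + tail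
  ∑-without-zero = trans (∑ˡ-map (outside ∷_) (subsets m) _)
    (trans (∑ˡ-cong (subsets m) λ E → cong (λ x → sign ∣ E ∣ ℤ.* + x)
      (𝟙-cong (allIn? P? (outside ∷ E)) (allIn? (P? ∘ suc) E)
        (λ h e e∈E → h (suc e) (there e∈E))
        (λ { h zero () ; h (suc e) (there e∈E) → h e e∈E }))) ih)

  withZero : ℤ
  withZero = ∑ˡ (subsets m) (λ E → sign (suc ∣ E ∣) ℤ.* + 𝟙 (allIn? P? (inside ∷ E)))

  ∑-with-zero : Dec (P zero) → withZero ≡ ℤ.- + (𝟙 (P? zero) * tail)
  ∑-with-zero (yes p) = trans (∑ˡ-cong (subsets m) λ E →
            trans (cong (λ x → sign (suc ∣ E ∣) ℤ.* + x)
                (𝟙-cong (allIn? P? (inside ∷ E)) (allIn? (P? ∘ suc) E)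
                  (λ h e e∈E → h (suc e) (there e∈E))
                  (λ { h zero _ → p ; h (suc e) (there e∈E) → h e e∈E })))
              (trans (ℤ.*-assoc -1ℤ (sign ∣ E ∣) _) (ℤ.-1*i≡-i (term E))))
    (trans (∑ˡ-neg (subsets m) term) (cong ℤ.-_ (trans ih
      (cong +_ (sym (trans (cong (_* tail) (𝟙-yes (P? zero) p)) (*-identityˡ tail)))))))
  ∑-with-zero (no ¬p) = trans (∑ˡ-cong (subsets m) λ E →
            trans (cong (λ x → sign (suc ∣ E ∣) ℤ.* + x)
                (𝟙-no (allIn? P? (inside ∷ E)) λ h → ¬p (h zero here)))
              (ℤ.*-zeroʳ (sign (suc ∣ E ∣))))
    (trans (∑ˡ-zero (subsets m)) (cong (λ x → ℤ.- + (x * tail)) (sym (𝟙-no (P? zero) ¬p))))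

  total : Dec (P zero) → + tail ℤ.+ ℤ.- + (𝟙 (P? zero) * tail) ≡ + 𝟙 (all? (¬? ∘ P?))
  total (yes p) rewrite 𝟙-yes (P? zero) p | *-identityˡ tail =
    trans (ℤ.+-inverseʳ (+ tail)) (cong +_ (sym (𝟙-no (all? (¬? ∘ P?)) λ h → h zero p)))
  total (no ¬p) rewrite 𝟙-no (P? zero) ¬p =
    trans (ℤ.+-identityʳ (+ tail)) (cong +_ (𝟙-cong (all? (¬? ∘ P? ∘ suc)) (all? (¬? ∘ P?))
      (λ { h zero → ¬p ; h (suc e) → h e }) (λ h → h ∘ suc)))

-- `∑-subsets` expands the indicator for each `x` separately; exchanging the two summations then
-- collects, for each `E`, the number `w E` of those `x` that satisfy all conditions in `E`.
inclusion-exclusion : ∀ {m n} {P : Fin n → Fin m → Set} (P? : ∀ x → Decidable (P x)) (w : Subset m → ℕ) →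
  (∀ E → Σℕ.sum (λ x → 𝟙 (allIn? (P? x) E)) ≡ w E) →
  + Σℕ.sum (λ x → 𝟙 (all? (¬? ∘ P? x))) ≡ ∑ˡ (subsets m) (λ E → sign ∣ E ∣ ℤ.* + w E)
inclusion-exclusion {m} {n} P? w ∑≡w = begin
  + Σℕ.sum (λ x → 𝟙 (all? (¬? ∘ P? x)))
    ≡⟨ +-∑ {n} _ ⟨
  Σℤ.sum (λ x → + 𝟙 (all? (¬? ∘ P? x)))
    ≡⟨ Σℤ.sum-cong-≗ {n} (λ x → ∑-subsets (P? x)) ⟨
  Σℤ.sum (λ x → ∑ˡ (subsets m) λ E → sign ∣ E ∣ ℤ.* + 𝟙 (allIn? (P? x) E))
    ≡⟨ ∑-∑ˡ-comm {n = n} (subsets m) _ ⟩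
  ∑ˡ (subsets m) (λ E → Σℤ.sum λ x → sign ∣ E ∣ ℤ.* + 𝟙 (allIn? (P? x) E))
    ≡⟨ ∑ˡ-cong (subsets m) (λ E → trans (sym (Σℤ.*-distribˡ-sum (sign ∣ E ∣) λ x → + 𝟙 (allIn? (P? x) E)))
         (cong (ℤ._*_ (sign ∣ E ∣)) (trans (+-∑ {n} _) (cong +_ (∑≡w E))))) ⟩
  ∑ˡ (subsets m) (λ E → sign ∣ E ∣ ℤ.* + w E)
    ∎
  where open ≡-Reasoning

-- Grouping graphs by size, isomorphism class and degree

-- The indicator is a Kronecker delta, and `a < m` ensures that some index `k` hits `a`.
∑-δ : ∀ m {a} (g : ℕ → ℤ) c → a < m → Σℤ.sum {m} (λ k → g (toℕ k) ℤ.* + (𝟙 (a ≟ toℕ k) * c)) ≡ g a ℤ.* + c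
∑-δ (suc m) {zero}  g c z<s = trans
  (cong₂ ℤ._+_ (cong (λ x → g 0 ℤ.* + x) (+-identityʳ c))
    (trans (Σℤ.sum-cong-≗ {m} λ k → ℤ.*-zeroʳ (g (suc (toℕ k)))) (Σℤ.sum-replicate-zero m)))
  (ℤ.+-identityʳ _)
∑-δ (suc m) {suc a} g c (s<s a<m) = trans
  (cong₂ ℤ._+_ (ℤ.*-zeroʳ (g 0)) (∑-δ m (g ∘ suc) c a<m)) (ℤ.+-identityˡ _)

sum-filter-∷ : ∀ {A : Set} {P : A → Set} (P? : Decidable P) (w : A → ℕ) x xs →
               sum (map w (filter P? (x ∷ xs))) ≡ 𝟙 (P? x) * w x + sum (map w (filter P? xs))
sum-filter-∷ P? w x xs with does (P? x)
... | true  = cong (_+ sum (map w (filter P? xs))) (sym (+-identityʳ (w x)))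
... | false = refl

∑ˡ-by-size : ∀ {A : Set} {m} (s : A → ℕ) (g : ℕ → ℤ) (w : A → ℕ) (xs : List A) → (∀ x → s x < m) →
             ∑ˡ xs (λ x → g (s x) ℤ.* + w x) ≡
             Σℤ.sum {m} (λ k → g (toℕ k) ℤ.* + sum (map w (filter (λ x → s x ≟ toℕ k) xs)))
∑ˡ-by-size {m = m} s g w []       s<m = sym
  (trans (Σℤ.sum-cong-≗ {m} λ k → ℤ.*-zeroʳ (g (toℕ k))) (Σℤ.sum-replicate-zero m))
∑ˡ-by-size {m = m} s g w (x ∷ xs) s<m = sym (trans
  (Σℤ.sum-cong-≗ {m} λ k → trans (cong (λ z → g (toℕ k) ℤ.* + z) (sum-filter-∷ (λ x → s x ≟ toℕ k) w x xs))
    (ℤ.*-distribˡ-+ (g (toℕ k)) (+ (𝟙 (s x ≟ toℕ k) * w x)) (+ sum (map w (filter (λ y → s y ≟ toℕ k) xs)))))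
  (trans (Σℤ.∑-distrib-+ {m} (λ k → g (toℕ k) ℤ.* + (𝟙 (s x ≟ toℕ k) * w x)) _)
    (cong₂ ℤ._+_ (∑-δ m g (w x) (s<m x)) (sym (∑ˡ-by-size s g w xs s<m)))))

filter-map : ∀ {A B : Set} {P : B → Set} (P? : Decidable P) (f : A → B) xs →
             filter P? (map f xs) ≡ map f (filter (P? ∘ f) xs)
filter-map P? f []       = refl
filter-map P? f (x ∷ xs) with does (P? (f x))
... | true  = cong (f x ∷_) (filter-map P? f xs)
... | false = filter-map P? f xs

-- Isolates the edgeless graph, whose contribution is the leading term of `ξ`.
subsets-empty : ∀ m → filter (λ E → ∣ E ∣ ≟ 0) (subsets m) ≡ ⊥ ∷ []
subsets-empty zero    = refl
subsets-empty (suc m) = trans (filter-++ size0? (map (outside ∷_) (subsets m)) _)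
  (cong₂ _++_
    (trans (filter-map size0? (outside ∷_) (subsets m)) (cong (map (outside ∷_)) (subsets-empty m)))
    (trans (filter-map size0? (inside ∷_) (subsets m))
      (cong (map (inside ∷_)) (filter-none (size0? ∘ (inside ∷_)) (All.universal (λ _ ()) (subsets m))))))
  where
  size0? : ∀ {m} (E : Subset m) → Dec (∣ E ∣ ≡ 0)
  size0? E = ∣ E ∣ ≟ 0

module _ {A : Set} {R : A → A → Set} (R? : Binary.Decidable R)
         (w : A → ℕ) (w-resp : ∀ {x r} → R x r → w x ≡ w r) where

  private
    -- For an equivalence relation this amounts to `¬ R r s`; the form with a common `x` is the one
    -- in which the counting meets it.
    Separates : A → A → Set
    Separates r s = ∀ {x} → R x r → ¬ R x s

  ∑-class-none : ∀ {x} rs → All (λ r → ¬ R x r) rs → sum (map (λ r → 𝟙 (R? x r) * w r) rs) ≡ 0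
  ∑-class-none     []       []         = refl
  ∑-class-none {x} (r ∷ rs) (¬p ∷ ¬ps) =
    cong₂ _+_ (cong (_* w r) (𝟙-no (R? x r) ¬p)) (∑-class-none rs ¬ps)

  ∑-class-one : ∀ {x} {rs} → Any (R x) rs → AllPairs Separates rs → sum (map (λ r → 𝟙 (R? x r) * w r) rs) ≡ w x
  ∑-class-one {x} {r ∷ rs} (here p) (seps ∷ _) = trans
    (cong₂ _+_ (trans (cong (_* w r) (𝟙-yes (R? x r) p)) (*-identityˡ (w r)))
      (∑-class-none rs (All.map (λ sep → sep p) seps)))
    (trans (+-identityʳ (w r)) (sym (w-resp p)))
  ∑-class-one {x} {r ∷ rs} (there any) (seps ∷ pairs) = cong₂ _+_
    (cong (_* w r) (𝟙-no (R? x r) λ p → let (sep , q) = All.lookupAny seps any in sep p q))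
    (∑-class-one any pairs)

  -- Double counting of the pairs `x`, `r` with `R x r`: each `x` has exactly one representative
  -- `r`, and `w` takes the same value at both.
  ∑-classes : ∀ xs {rs} → All (λ x → Any (R x) rs) xs → AllPairs Separates rs →
              sum (map w xs) ≡ sum (map (λ r → length (filter (λ x → R? x r) xs) * w r) rs)
  ∑-classes []       {rs} []             seps = sym (zeros rs)
    where
    zeros : ∀ rs → sum (map (λ _ → 0) rs) ≡ 0
    zeros []       = refl
    zeros (_ ∷ rs) = zeros rs
  ∑-classes (x ∷ xs) {rs} (any ∷ anys) seps = trans
    (cong₂ _+_ (sym (∑-class-one any seps)) (∑-classes xs anys seps)) (step rs)
    where
    length-filter-∷ : ∀ r → length (filter (λ x → R? x r) (x ∷ xs)) ≡
                            𝟙 (R? x r) + length (filter (λ x → R? x r) xs)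
    length-filter-∷ r with does (R? x r)
    ... | true  = refl
    ... | false = refl
    step : ∀ rs → sum (map (λ r → 𝟙 (R? x r) * w r) rs)
                + sum (map (λ r → length (filter (λ x → R? x r) xs) * w r) rs)
                ≡ sum (map (λ r → length (filter (λ x → R? x r) (x ∷ xs)) * w r) rs)
    step []       = refl
    step (r ∷ rs) rewrite length-filter-∷ r = trans
      (interchange (𝟙 (R? x r) * w r) _ _ _)
      (cong₂ _+_ (sym (*-distribʳ-+ (w r) (𝟙 (R? x r)) _)) (step rs))

product-upTo : ∀ b (f : ℕ → ℕ) → product (map f (upTo b)) ≡ ∏ {b} (f ∘ toℕ)
product-upTo b f = trans (cong product (map-upTo f b)) (go b f)
  where
  go : ∀ b f → product (applyUpTo f b) ≡ ∏ {b} (f ∘ toℕ)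
  go zero    f = refl
  go (suc b) f = cong (f 0 *_) (go b (f ∘ suc))

^-∑ : ∀ {m} c (f : Fin m → ℕ) → c ^ Σℕ.sum f ≡ ∏ (λ i → c ^ f i)
^-∑ {zero}  c f = refl
^-∑ {suc m} c f = trans (^-distribˡ-+-* c (f zero) _) (cong (c ^ f zero *_) (^-∑ c (f ∘ suc)))

-- Factors with index i ≥ b may be left out since F i ≡ 1 there; this is why weight stops at n − 2.
∏-δ : ∀ b (F : ℕ → ℕ) a → (∀ i → b ≤ i → F i ≡ 1) → ∏ {b} (λ i → F (toℕ i) ^ 𝟙 (a ≟ toℕ i)) ≡ F a
∏-δ zero    F a       F≡1 = sym (F≡1 a z≤n)
∏-δ (suc b) F zero    F≡1 = trans (cong₂ _*_ (^-identityʳ (F 0)) (trans (∏-const b 1) (^-zeroˡ b)))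
                              (*-identityʳ (F 0))
∏-δ (suc b) F (suc a) F≡1 = trans (*-identityˡ _) (∏-δ b (F ∘ suc) a λ i b≤i → F≡1 (suc i) (s≤s b≤i))

-- With the exponent written as a sum of indicators, the products over values and over vertices can
-- be exchanged; each vertex then keeps only the factor of its own value.
∏-by-value : ∀ {m} b (F : ℕ → ℕ) (d : Fin m → ℕ) → (∀ i → b ≤ i → F i ≡ 1) →
             ∏ {b} (λ i → F (toℕ i) ^ count (λ r → d r ≟ toℕ i) (allFin m)) ≡ ∏ (F ∘ d)
∏-by-value {m} b F d F≡1 = begin
  ∏ {b} (λ i → F (toℕ i) ^ count (λ r → d r ≟ toℕ i) (allFin m))
    ≡⟨ ∏-cong {b} (λ i → trans (cong (F (toℕ i) ^_) (count-∑ λ r → d r ≟ toℕ i)) (^-∑ {m} (F (toℕ i)) _)) ⟩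
  ∏ {b} (λ i → ∏ λ r → F (toℕ i) ^ 𝟙 (d r ≟ toℕ i))
    ≡⟨ Πℕ.∑-comm {b} (λ i r → F (toℕ i) ^ 𝟙 (d r ≟ toℕ i)) ⟩
  ∏ (λ r → ∏ {b} λ i → F (toℕ i) ^ 𝟙 (d r ≟ toℕ i))
    ≡⟨ ∏-cong (λ r → ∏-δ b F (d r) F≡1) ⟩
  ∏ (F ∘ d)
    ∎
  where open ≡-Reasoning

vertexProduct : ∀ {n} → BipartiteGraph n → ℕ
vertexProduct {n} g = ∏ (λ r → (n ∸ degreeᴿ g r) !) * ∏ (λ c → (n ∸ degreeᶜ g c) !)

weight≡vertexProduct : ∀ {n} (g : BipartiteGraph n) → weight g ≡ vertexProduct g
weight≡vertexProduct {n} g = begin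
  weight g
    ≡⟨ product-upTo b _ ⟩
  ∏ {b} (λ i → F (toℕ i) ^ ψ (toℕ i) g)
    ≡⟨ ∏-cong {b} (λ i → ^-distribˡ-+-* (F (toℕ i)) (R i) (C i)) ⟩
  ∏ {b} (λ i → F (toℕ i) ^ R i * F (toℕ i) ^ C i)
    ≡⟨ Πℕ.∑-distrib-+ {b} (λ i → F (toℕ i) ^ R i) (λ i → F (toℕ i) ^ C i) ⟩
  ∏ {b} (λ i → F (toℕ i) ^ R i) * ∏ {b} (λ i → F (toℕ i) ^ C i)
    ≡⟨ cong₂ _*_ (∏-by-value b F (degreeᴿ g) F≡1) (∏-by-value b F (degreeᶜ g) F≡1) ⟩
  vertexProduct g
    ∎
  where
  open ≡-Reasoning
  b = n ∸ 1
  F : ℕ → ℕ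
  F i = (n ∸ i) !
  R C : Fin b → ℕ
  R i = count (λ r → degreeᴿ g r ≟ toℕ i) (allFin n)
  C i = count (λ c → degreeᶜ g c ≟ toℕ i) (allFin n)
  ≤1⇒!≡1 : ∀ {k} → k ≤ 1 → k ! ≡ 1
  ≤1⇒!≡1 z≤n       = refl
  ≤1⇒!≡1 (s≤s z≤n) = refl
  -- From `i ≥ n ∸ 1` follows `n ∸ i ≤ 1`, and 0! = 1! = 1.
  F≡1 : ∀ i → b ≤ i → F i ≡ 1
  F≡1 i b≤i = ≤1⇒!≡1 (m≤n+o⇒m∸n≤o n i
    (≤-trans (m≤n+m∸n n 1) (≤-trans (s≤s b≤i) (≤-reflexive (+-comm 1 i)))))

degreeᴿ-≅ : ∀ {n} {g h : BipartiteGraph n} ((ρ , _) : g ≅ h) r → degreeᴿ g r ≡ degreeᴿ h (ρ ⟨$⟩ʳ r)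
degreeᴿ-≅ {g = g} {h} (ρ , σ , iso) r = begin
  degreeᴿ g r                                        ≡⟨ count-∑ (λ c → ⟨ r , c ⟩∈? g) ⟩
  Σℕ.sum (λ c → 𝟙 (⟨ r , c ⟩∈? g))                   ≡⟨ Σℕ.sum-cong-≗ (λ c → 𝟙-cong
                                                          (⟨ r , c ⟩∈? g) (⟨ ρ ⟨$⟩ʳ r , σ ⟨$⟩ʳ c ⟩∈? h)
                                                          (Equivalence.to (iso r c)) (Equivalence.from (iso r c))) ⟩
  Σℕ.sum (λ c → 𝟙 (⟨ ρ ⟨$⟩ʳ r , σ ⟨$⟩ʳ c ⟩∈? h))     ≡⟨ Σℕ.sum-permute (λ c → 𝟙 (⟨ ρ ⟨$⟩ʳ r , c ⟩∈? h)) σ ⟨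
  Σℕ.sum (λ c → 𝟙 (⟨ ρ ⟨$⟩ʳ r , c ⟩∈? h))            ≡⟨ count-∑ (λ c → ⟨ ρ ⟨$⟩ʳ r , c ⟩∈? h) ⟨
  degreeᴿ h (ρ ⟨$⟩ʳ r)                               ∎
  where open ≡-Reasoning

degreeᶜ-≅ : ∀ {n} {g h : BipartiteGraph n} ((_ , σ , _) : g ≅ h) c → degreeᶜ g c ≡ degreeᶜ h (σ ⟨$⟩ʳ c)
degreeᶜ-≅ {g = g} {h} (ρ , σ , iso) c = begin
  degreeᶜ g c                                        ≡⟨ count-∑ (λ r → ⟨ r , c ⟩∈? g) ⟩
  Σℕ.sum (λ r → 𝟙 (⟨ r , c ⟩∈? g))                   ≡⟨ Σℕ.sum-cong-≗ (λ r → 𝟙-cong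
                                                          (⟨ r , c ⟩∈? g) (⟨ ρ ⟨$⟩ʳ r , σ ⟨$⟩ʳ c ⟩∈? h)
                                                          (Equivalence.to (iso r c)) (Equivalence.from (iso r c))) ⟩
  Σℕ.sum (λ r → 𝟙 (⟨ ρ ⟨$⟩ʳ r , σ ⟨$⟩ʳ c ⟩∈? h))     ≡⟨ Σℕ.sum-permute (λ r → 𝟙 (⟨ r , σ ⟨$⟩ʳ c ⟩∈? h)) ρ ⟨
  Σℕ.sum (λ r → 𝟙 (⟨ r , σ ⟨$⟩ʳ c ⟩∈? h))            ≡⟨ count-∑ (λ r → ⟨ r , σ ⟨$⟩ʳ c ⟩∈? h) ⟨
  degreeᶜ h (σ ⟨$⟩ʳ c)                               ∎
  where open ≡-Reasoning

-- Isomorphisms preserve degrees and keep the sides apart, so ρ reindexes one product and σ the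
-- other. This invariance lets a representative stand for its whole class.
vertexProduct-≅ : ∀ {n} {g h : BipartiteGraph n} → g ≅ h → vertexProduct g ≡ vertexProduct h
vertexProduct-≅ {n} {g} {h} g≅h@(ρ , σ , _) = cong₂ _*_
  (trans (∏-cong λ r → cong (λ d → (n ∸ d) !) (degreeᴿ-≅ {g = g} {h} g≅h r))
    (sym (Πℕ.sum-permute (λ r → (n ∸ degreeᴿ h r) !) ρ)))
  (trans (∏-cong λ c → cong (λ d → (n ∸ d) !) (degreeᶜ-≅ {g = g} {h} g≅h c))
    (sym (Πℕ.sum-permute (λ c → (n ∸ degreeᶜ h c) !) σ)))

vertexProduct-⊥ : ∀ n → vertexProduct (graph {n} ⊥) ≡ (n !) ^ (2 * n)
vertexProduct-⊥ n = begin
  vertexProduct (graph {n} ⊥)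
    ≡⟨ cong₂ _*_ (∏-cong λ r → cong (λ d → (n ∸ d) !) (no-edge λ c → (⟨ r , c ⟩∈? graph {n} ⊥) , ∉⊥))
                 (∏-cong λ c → cong (λ d → (n ∸ d) !) (no-edge λ r → (⟨ r , c ⟩∈? graph {n} ⊥) , ∉⊥)) ⟩
  ∏ {n} (λ _ → n !) * ∏ {n} (λ _ → n !)
    ≡⟨ ∏-const-squared n (n !) ⟩
  (n !) ^ (2 * n)
    ∎
  where
  open ≡-Reasoning
  no-edge : {P : Fin n → Set} (P? : ∀ i → Dec (P i) × ¬ P i) → count (proj₁ ∘ P?) (allFin n) ≡ 0
  no-edge P? = trans (count-∑ (proj₁ ∘ P?)) (trans
    (Σℕ.sum-cong-≗ λ i → 𝟙-no (proj₁ (P? i)) (proj₂ (P? i))) (Σℕ.sum-replicate-zero n))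

-- Undoes the passage to isomorphism classes: class size times weight, summed over representatives,
-- is a plain sum over the edge sets of size `k`.
classSum≡ : ∀ n k → classSum n k ≡
            sum (map (vertexProduct {n} ∘ graph) (filter (λ E → ∣ E ∣ ≟ k) (subsets (n * n))))
classSum≡ n k = sym (begin
  sum (map (vertexProduct {n} ∘ graph) (filter (λ E → ∣ E ∣ ≟ k) (subsets (n * n))))
    ≡⟨ cong sum (map-∘ {g = vertexProduct {n}} {f = graph} (filter (λ E → ∣ E ∣ ≟ k) (subsets (n * n)))) ⟩
  sum (map vertexProduct (𝔊 n k))
    ≡⟨ ∑-classes _≅?_ vertexProduct (λ {g} {h} → vertexProduct-≅ {g = g} {h}) (𝔊 n k)
         (All.tabulate 𝔊/≅-complete)
         (AllPairs.map (λ {r} {s} r≇s {g} g≅r g≅s → r≇s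
             (≅-trans {f = r} {g} {s} (≅-sym {g = g} {r} g≅r) g≅s)) (𝔊/≅-distinct n k)) ⟩
  sum (map (λ g → length (isoClass k g) * vertexProduct g) (𝔊/≅ n k))
    ≡⟨ cong sum (map-cong (λ g → cong (length (isoClass k g) *_) (sym (weight≡vertexProduct g))) (𝔊/≅ n k)) ⟩
  classSum n k
    ∎)
  where open ≡-Reasoning

ξ-as-alternating-sum : ∀ n → ξ n ≡ ∑ˡ (subsets (n * n)) (λ E → sign ∣ E ∣ ℤ.* + vertexProduct (graph {n} E))
ξ-as-alternating-sum n = sym (begin
  ∑ˡ (subsets (n * n)) (λ E → sign ∣ E ∣ ℤ.* + vertexProduct (graph {n} E))
    -- The sizes run from 0 to n², hence `suc (n * n)` of them. Size 0 then splits off by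
    -- computation, which accounts for the shifted index in `ξ`.
    ≡⟨ ∑ˡ-by-size ∣_∣ sign (vertexProduct {n} ∘ graph) (subsets (n * n)) (λ E → s≤s (∣p∣≤n E)) ⟩
  Σℤ.sum {suc (n * n)} (λ k → sign (toℕ k) ℤ.* + ofSize (toℕ k))
    ≡⟨⟩
  sign 0 ℤ.* + ofSize 0 ℤ.+ Σℤ.sum {n * n} (λ k → sign (suc (toℕ k)) ℤ.* + ofSize (suc (toℕ k)))
    ≡⟨ cong₂ ℤ._+_ (trans (ℤ.*-identityˡ _) (cong +_ empty))
         (Σℤ.sum-cong-≗ λ (k : Fin (n * n)) → cong (λ x → sign (suc (toℕ k)) ℤ.* + x)
           (sym (classSum≡ n (suc (toℕ k))))) ⟩
  ξ n
    ∎)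
  where
  open ≡-Reasoning
  ofSize : ℕ → ℕ
  ofSize k = sum (map (vertexProduct ∘ graph {n}) (filter (λ E → ∣ E ∣ ≟ k) (subsets (n * n))))
  empty : ofSize 0 ≡ (n !) ^ (2 * n)
  empty = trans (cong (sum ∘ map (vertexProduct ∘ graph {n})) (subsets-empty (n * n)))
    (trans (+-identityʳ _) (vertexProduct-⊥ n))

-- S-permutation matrices as arrays of permutations

does⇒ : ∀ {P : Set} (P? : Dec P) → does P? ≡ true → P
does⇒ (yes p) _ = p

∀-combine : ∀ {m n} (P : Fin (m * n) → Set) → (∀ (k : Fin m) (i : Fin n) → P (combine k i)) → ∀ x → P x
∀-combine {m} {n} P h x = subst P (combine-remQuot {m} n x) (h _ _)

PermutationArrays : ℕ → Setoid 0ℓ 0ℓ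
PermutationArrays n = ∏ˢ {n} (λ _ → Permutations n) ×ₛ ∏ˢ {n} (λ _ → Permutations n)

Arrays : ℕ → Set
Arrays n = Setoid.Carrier (PermutationArrays n)

private
  variable
    n : ℕ

infix 4 _≈ₐ_

_≈ₐ_ : Arrays n → Arrays n → Set
_≈ₐ_ {n} = Setoid._≈_ (PermutationArrays n)

Card-PermutationArrays : ∀ n → Card (PermutationArrays n) ((n !) ^ (2 * n))
Card-PermutationArrays n = subst (Card (PermutationArrays n)) (∏-const-squared n (n !))
  (Card-× (Card-∏ λ _ → Card-Permutations n) (Card-∏ λ _ → Card-Permutations n))

-- block (k , l) of the matrix has a 1 in position (i , j)
One : Arrays n → (k i l j : Fin n) → Set
One (ρ , σ) k i l j = ρ k ⟨$⟩ʳ l ≡ i × σ l ⟨$⟩ʳ k ≡ j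

one? : (t : Arrays n) → ∀ k i l j → Dec (One t k i l j)
one? (ρ , σ) k i l j = (ρ k ⟨$⟩ʳ l ≟ᶠ i) ×-dec (σ l ⟨$⟩ʳ k ≟ᶠ j)

matrix : Arrays n → BinaryMatrix (n * n) (n * n)
matrix {n} t x y = does (one? t (quotient n x) (remainder {n} n x) (quotient n y) (remainder {n} n y))

matrix-combine : ∀ (t : Arrays n) k i l j → matrix t (combine k i) (combine l j) ≡ does (one? t k i l j)
matrix-combine t k i l j = cong₂ (λ (k , i) (l , j) → does (one? t k i l j))
  (remQuot-combine k i) (remQuot-combine l j)

matrix⇒ : ∀ (t : Arrays n) k i l j → matrix t (combine k i) (combine l j) ≡ true → One t k i l j
matrix⇒ t k i l j eq = does⇒ (one? t k i l j) (trans (sym (matrix-combine t k i l j)) eq)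

matrix⇐ : ∀ (t : Arrays n) k i l j → One t k i l j → matrix t (combine k i) (combine l j) ≡ true
matrix⇐ t k i l j one = trans (matrix-combine t k i l j) (dec-true (one? t k i l j) one)

matrix-isSPermutation : (t : Arrays n) → IsSPermutation n (matrix t)
matrix-isSPermutation {n} t@(ρ , σ) = record
  { row-one = ∀-combine {n} {n} _ λ k i →
      -- Row `i` of block row `k` has its 1 in the only block whose 1 lies in row `i`, that is,
      -- where ρ_k(l) = i.
      let l = ρ k ⟨$⟩ˡ i in
      combine l (σ l ⟨$⟩ʳ k) , matrix⇐ t k i l _ (inverseʳ (ρ k) , refl)
      , λ {y} → ∀-combine {n} {n} (λ y → matrix t (combine k i) y ≡ true → combine l (σ l ⟨$⟩ʳ k) ≡ y)
          (λ l′ j′ eq → row k l′ (matrix⇒ t k i l′ j′ eq)) y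
  ; col-one = ∀-combine {n} {n} _ λ l j →
      let k = σ l ⟨$⟩ˡ j in
      combine k (ρ k ⟨$⟩ʳ l) , matrix⇐ t k _ l j (refl , inverseʳ (σ l))
      , λ {x} → ∀-combine {n} {n} (λ x → matrix t x (combine l j) ≡ true → combine k (ρ k ⟨$⟩ʳ l) ≡ x)
          (λ k′ i′ eq → col k′ l (matrix⇒ t k′ i′ l j eq)) x
  ; block-one = λ k l → (ρ k ⟨$⟩ʳ l , σ l ⟨$⟩ʳ k) , matrix⇐ t k _ l _ (refl , refl)
      , λ { {i , j} eq → let (p , q) = matrix⇒ t k i l j eq in cong₂ _,_ p q }
  }
  where
  row : ∀ k l {i j} → One t k i l j → combine (ρ k ⟨$⟩ˡ i) (σ (ρ k ⟨$⟩ˡ i) ⟨$⟩ʳ k) ≡ combine l j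
  row k l (refl , refl) = cong (λ l → combine l (σ l ⟨$⟩ʳ k)) (inverseˡ (ρ k))
  col : ∀ k l {i j} → One t k i l j → combine (σ l ⟨$⟩ˡ j) (ρ (σ l ⟨$⟩ˡ j) ⟨$⟩ʳ l) ≡ combine k i
  col k l (refl , refl) = cong (λ k → combine k (ρ k ⟨$⟩ʳ l)) (inverseˡ (σ l))

matrix-cong : {t u : Arrays n} → t ≈ₐ u → matrix t ≋ matrix u
matrix-cong (ρ≈ , σ≈) x y = cong₂ (λ i j → does ((i ≟ᶠ _) ×-dec (j ≟ᶠ _))) (ρ≈ _ _) (σ≈ _ _)

-- The 1 that `t` puts in a block is also a 1 of `u`, and its position there can only be the one
-- given by the permutations of `u`.
matrix-injective : {t u : Arrays n} → matrix t ≋ matrix u → t ≈ₐ u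
matrix-injective {t = t} {u} eq =
  (λ k l → sym (proj₁ (common k l))) , (λ l k → sym (proj₂ (common k l)))
  where
  common : ∀ k l → One u k (proj₁ t k ⟨$⟩ʳ l) l (proj₂ t l ⟨$⟩ʳ k)
  common k l = matrix⇒ u k _ l _ (trans (sym (eq _ _)) (matrix⇐ t k _ l _ (refl , refl)))

matrix-surjective : ∀ {A} → IsSPermutation n A → ∃ λ t → matrix t ≋ A
matrix-surjective {n} {A} isA = t ,
  ∀-combine {n} {n} (λ x → ∀ y → matrix t x y ≡ A x y) λ k i →
  ∀-combine {n} {n} (λ y → matrix t (combine k i) y ≡ A (combine k i) y) λ l j →
  ⇔→≡ (mk⇔ (λ eq → let (p , q) = matrix⇒ t k i l j eq in
                   subst₂ (λ i j → block n A k l i j ≡ true) p q (pos-one k l))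
           (λ eq → let p = pos-unique k l eq in
                   matrix⇐ t k i l j (cong proj₁ p , cong proj₂ p)))
  where
  open IsSPermutation isA
  pos : Fin n → Fin n → Fin n × Fin n
  pos k l = proj₁ (block-one k l)
  pos-one : ∀ k l → block n A k l (proj₁ (pos k l)) (proj₂ (pos k l)) ≡ true
  pos-one k l = proj₁ (proj₂ (block-one k l))
  pos-unique : ∀ k l {i j} → block n A k l i j ≡ true → pos k l ≡ (i , j)
  pos-unique k l = proj₂ (proj₂ (block-one k l))

  column : Fin n → Fin n → Fin (n * n)
  column k i = proj₁ (row-one (combine k i))
  line : Fin n → Fin n → Fin (n * n)
  line l j = proj₁ (col-one (combine l j))

  -- The inverse sends row `i` to the block column containing its 1. One composite is the identity
  -- by uniqueness within the block, the other by uniqueness within the row; for `σ`, columns take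
  -- the place of rows.
  ρ : Fin n → Permutation′ n
  ρ k = permutation (λ l → proj₁ (pos k l)) (λ i → quotient n (column k i))
    (λ i → cong proj₁ (pos-unique k _
      (trans (cong (A (combine k i)) (combine-remQuot {n} n (column k i)))
        (proj₁ (proj₂ (row-one (combine k i)))))))
    (λ l → trans (cong (quotient n) (proj₂ (proj₂ (row-one _)) (pos-one k l)))
      (cong proj₁ (remQuot-combine l (proj₂ (pos k l)))))

  σ : Fin n → Permutation′ n
  σ l = permutation (λ k → proj₂ (pos k l)) (λ j → quotient n (line l j))
    (λ j → cong proj₂ (pos-unique _ l
      (trans (cong (λ x → A x (combine l j)) (combine-remQuot {n} n (line l j)))
        (proj₁ (proj₂ (col-one (combine l j)))))))
    (λ k → trans (cong (quotient n) (proj₂ (proj₂ (col-one _)) (pos-one k l)))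
      (cong proj₁ (remQuot-combine k (proj₁ (pos k l)))))

  t : Arrays n
  t = ρ , σ

-- Agreement of arrays and disjointness of matrices

Agree : Arrays n → Arrays n → Fin n → Fin n → Set
Agree (ρ , σ) (ρ′ , σ′) k l = ρ k ⟨$⟩ʳ l ≡ ρ′ k ⟨$⟩ʳ l × σ l ⟨$⟩ʳ k ≡ σ′ l ⟨$⟩ʳ k

-- Blocks are coded in `Fin (n * n)` exactly as edges are, so a set of blocks is at once the edge
-- set of a graph between block rows and block columns.
AgreeAt : Arrays n → Arrays n → Fin (n * n) → Set
AgreeAt {n} t u e = uncurry (Agree t u) (remQuot n e)

agreeAt? : (t u : Arrays n) → Decidable (AgreeAt t u)
agreeAt? t u e = (_ ≟ᶠ _) ×-dec (_ ≟ᶠ _)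

AgreeAt-combine : ∀ (t u : Arrays n) k l → AgreeAt t u (combine k l) ≡ Agree t u k l
AgreeAt-combine t u k l = cong (uncurry (Agree t u)) (remQuot-combine k l)

NowhereAgree : Arrays n → Arrays n → Set
NowhereAgree {n} t u = ∀ e → ¬ AgreeAt t u e

nowhereAgree? : (t u : Arrays n) → Dec (NowhereAgree t u)
nowhereAgree? t u = all? λ e → ¬? (agreeAt? t u e)

disjoint⇒ : ∀ {t u : Arrays n} → Disjoint (matrix t) (matrix u) → NowhereAgree t u
disjoint⇒ {t = t} {u} disj e (p , q) =
  disj (_ , _ , matrix⇐ t _ _ _ _ (refl , refl) , matrix⇐ u _ _ _ _ (sym p , sym q))

disjoint⇐ : ∀ {t u : Arrays n} → NowhereAgree t u → Disjoint (matrix t) (matrix u)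
disjoint⇐ {n} {t = t} {u} nowhere (x , y , p , q) =
  ∀-combine {n} {n} (λ x → ∀ y → matrix t x y ≡ true → ¬ matrix u x y ≡ true)
    (λ k i → ∀-combine {n} {n} (λ y → matrix t (combine k i) y ≡ true → ¬ matrix u (combine k i) y ≡ true)
      λ l j p q →
        let (a , b) = matrix⇒ t k i l j p ; (a′ , b′) = matrix⇒ u k i l j q in
        nowhere (combine k l) (subst id (sym (AgreeAt-combine t u k l)) (trans a (sym a′) , trans b (sym b′))))
    x y p q

-- Regrouping the conditions by vertex turns the set into a product of sets `Agreeing`, one per
-- vertex, with the neighbours as prescribed places. Only the proofs are rearranged; the
-- permutations stay as they are, so the inverse laws are identities.
Card-agree : ∀ (t : Arrays n) (E : Subset (n * n)) →
             Card (PermutationArrays n ∣ˢ λ u → ∀ e → e ∈ˢ E → AgreeAt t u e) (vertexProduct (graph {n} E))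
Card-agree {n} t@(ρ , σ) E = Card-resp rearrange
  (Card-× (Card-∏ λ r → Card-Agreeing (ρ r) (λ c → ⟨ r , c ⟩∈? g))
          (Card-∏ λ c → Card-Agreeing (σ c) (λ r → ⟨ r , c ⟩∈? g)))
  where
  g = graph {n} E
  at : ∀ {u} → (∀ e → e ∈ˢ E → AgreeAt t u e) → ∀ r c → ⟨ r , c ⟩∈ g → Agree t u r c
  at {u} h r c rc = subst id (AgreeAt-combine t u r c) (h _ rc)
  rearrange : Inverse (∏ˢ (λ r → Agreeing (ρ r) (λ c → ⟨ r , c ⟩∈ g)) ×ₛ
                       ∏ˢ (λ c → Agreeing (σ c) (λ r → ⟨ r , c ⟩∈ g)))
                      (PermutationArrays n ∣ˢ λ u → ∀ e → e ∈ˢ E → AgreeAt t u e)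
  rearrange = record
    { to        = λ (f , h) → ((λ r → proj₁ (f r)) , (λ c → proj₁ (h c)))
        , ∀-combine {n} {n} _ λ r c rc → subst id
            (sym (AgreeAt-combine t ((λ r → proj₁ (f r)) , (λ c → proj₁ (h c))) r c))
            (proj₂ (f r) c rc , proj₂ (h c) r rc)
    ; from      = λ ((ρ′ , σ′) , agree) →
        (λ r → ρ′ r , λ c rc → proj₁ (at {ρ′ , σ′} agree r c rc)) ,
        (λ c → σ′ c , λ r rc → proj₂ (at {ρ′ , σ′} agree r c rc))
    ; to-cong   = id
    ; from-cong = id
    ; inverse   = id , id
    }

module _ {N : ℕ} (enumeration : Card (PermutationArrays n) N) where

  open Inverse enumeration using (to; from; strictlyInverseˡ)

  -- For each `E` the arrays agreeing with `t` on `E` are counted twice, by filtering the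
  -- enumeration and by `Card-agree`. The result does not involve `t`.
  ∑-nowhereAgree : ∀ t → + Σℕ.sum (λ (b : Fin N) → 𝟙 (nowhereAgree? t (to b))) ≡ ξ n
  ∑-nowhereAgree t = trans
    (inclusion-exclusion (λ b → agreeAt? t (to b)) (vertexProduct ∘ graph {n}) λ E →
      Card-unique
        (Card-resp
          (∣ˢ-inverse enumeration
            {Q = λ u → ∀ e → e ∈ˢ E → AgreeAt t u e} id
            -- Decoding the code of `u` gives `u` back only up to pointwise equality, so the
            -- agreement is carried over value by value.
            (λ {u} agree e e∈E → let (p , q) = agree e e∈E ; (ρ≈ , σ≈) = strictlyInverseˡ u in
              trans p (sym (ρ≈ _ _)) , trans q (sym (σ≈ _ _))))
          (Card-filter (λ b → allIn? (agreeAt? t (to b)) E)))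
        (Card-agree t E))
    (sym (ξ-as-alternating-sum n))

-- Non-ordered pairs

∑-const : ∀ m z → Σℤ.sum {m} (λ _ → z) ≡ + m ℤ.* z
∑-const zero    z = sym (ℤ.*-zeroˡ z)
∑-const (suc m) z = trans (cong (ℤ._+_ z) (∑-const m z)) (sym (ℤ.suc-* (+ m) z))

-- Since `_/_` reduces to lowest terms, the equation is moved to unnormalised fractions, where
-- cross-multiplication turns it into the hypothesis.
half-/ : ∀ (a x : ℤ) η → + (η + η) ≡ a ℤ.* x → (+ η) / 1 ≡ (a / 2) ℚ.* (x / 1)
half-/ a x η 2η≡ax = ℚ.toℚᵘ-injective (begin
  toℚᵘ ((+ η) / 1)                          ≈⟨ ℚ.toℚᵘ-fromℚᵘ (ℚᵘ.mkℚᵘ (+ η) 0) ⟩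
  ℚᵘ.mkℚᵘ (+ η) 0                           ≈⟨ ℚᵘ.*≡* cross ⟩
  ℚᵘ.mkℚᵘ a 1 ℚᵘ.* ℚᵘ.mkℚᵘ x 0              ≈⟨ ℚᵘ.*-cong (ℚ.toℚᵘ-fromℚᵘ (ℚᵘ.mkℚᵘ a 1)) (ℚ.toℚᵘ-fromℚᵘ (ℚᵘ.mkℚᵘ x 0)) ⟨
  toℚᵘ (a / 2) ℚᵘ.* toℚᵘ (x / 1)            ≈⟨ ℚ.toℚᵘ-homo-* (a / 2) (x / 1) ⟨
  toℚᵘ ((a / 2) ℚ.* (x / 1))                ∎)
  where
  open ℚᵘ.≃-Reasoning
  cross : + η ℤ.* + 2 ≡ a ℤ.* x ℤ.* + 1
  cross = trans (ℤ.*-comm (+ η) (+ 2)) (trans (ℤ.suc-* (+ 1) (+ η))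
    (trans (cong (ℤ._+_ (+ η)) (ℤ.*-identityˡ (+ η))) (trans 2η≡ax (sym (ℤ.*-identityʳ (a ℤ.* x))))))

NowhereAgree-sym : ∀ {n} {t u : Arrays n} → NowhereAgree t u → NowhereAgree u t
NowhereAgree-sym nowhere e (p , q) = nowhere e (sym p , sym q)

-- Positivity of `n` supplies a block in which `t` meets itself; the empty matrix, for n = 0, would
-- be disjoint from itself.
NowhereAgree-irrefl : ∀ {n} .{{_ : NonZero n}} (t : Arrays n) → ¬ NowhereAgree t t
NowhereAgree-irrefl {suc n} t nowhere = nowhere zero (refl , refl)

module _ {n : ℕ} .{{_ : NonZero n}} {N : ℕ} (enumeration : Card (PermutationArrays n) N) where

  open Inverse enumeration using (to; from; strictlyInverseˡ; strictlyInverseʳ; from-cong)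

  -- A non-ordered pair is represented by its ordering in which the code of the
  -- first matrix is the smaller one.
  Increasing : Fin N → Fin N → Set
  Increasing a b = a Fin.< b × NowhereAgree (to a) (to b)

  increasing? : ∀ a b → Dec (Increasing a b)
  increasing? a b = (a <? b) ×-dec nowhereAgree? (to a) (to b)

  -- A pair of codes becomes a single element of `Fin (N * N)`, so that `Card-filter` can count the
  -- increasing ones.
  IncreasingCode : Fin (N * N) → Set
  IncreasingCode x = Increasing (quotient N x) (remainder {N} N x)

  increasingCode? : Decidable IncreasingCode
  increasingCode? x = increasing? (quotient N x) (remainder {N} N x)

  #increasing : ℕ
  #increasing = Σℕ.sum (𝟙 ∘ increasingCode?)

  #increasing-∑ : #increasing ≡ Σℕ.sum λ a → Σℕ.sum λ b → 𝟙 (increasing? a b)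
  #increasing-∑ = trans (∑-combine N (𝟙 ∘ increasingCode?))
    (Σℕ.sum-cong-≗ {N} λ a → Σℕ.sum-cong-≗ {N} λ b →
      cong (λ (a , b) → 𝟙 (increasing? a b)) (remQuot-combine a b))

  -- By trichotomy exactly one of the two orders can be increasing when the codes differ; on the
  -- diagonal all three indicators vanish, by irreflexivity.
  𝟙-nowhereAgree : ∀ a b → 𝟙 (nowhereAgree? (to a) (to b)) ≡ 𝟙 (increasing? a b) + 𝟙 (increasing? b a)
  𝟙-nowhereAgree a b with <-cmp a b
  ... | tri< a<b _ a≯b = trans (sym (+-identityʳ _)) (cong₂ _+_
    (𝟙-cong (nowhereAgree? (to a) (to b)) (increasing? a b) (a<b ,_) proj₂)
    (sym (𝟙-no (increasing? b a) (a≯b ∘ proj₁))))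
  ... | tri≈ _ refl _  = trans
    (𝟙-no (nowhereAgree? (to a) (to a)) (NowhereAgree-irrefl (to a)))
    (sym (cong₂ _+_ irr irr))
    where
    irr = 𝟙-no (increasing? a a) (<-irrefl refl ∘ proj₁)
  ... | tri> a≮b _ b<a = cong₂ _+_
    (sym (𝟙-no (increasing? a b) (a≮b ∘ proj₁)))
    (𝟙-cong (nowhereAgree? (to a) (to b)) (increasing? b a)
      (λ d → b<a , NowhereAgree-sym {t = to a} {to b} d) (λ (_ , d) → NowhereAgree-sym {t = to b} {to a} d))

  -- Exchanging the summations in the second copy makes it count decreasing pairs, so both copies
  -- together count all ordered pairs: ξ_n partners for each of the `N` first members.
  #increasing-double : + (#increasing + #increasing) ≡ + N ℤ.* ξ n
  #increasing-double = begin
    + (#increasing + #increasing)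
      ≡⟨ cong +_ (cong₂ _+_ #increasing-∑ (trans #increasing-∑ (Σℕ.∑-comm {N} {N} λ a b → 𝟙 (increasing? a b)))) ⟩
    + (Σℕ.sum (λ a → Σℕ.sum λ b → 𝟙 (increasing? a b)) + Σℕ.sum (λ a → Σℕ.sum λ b → 𝟙 (increasing? b a)))
      ≡⟨ cong +_ (Σℕ.∑-distrib-+ {N} (λ a → Σℕ.sum λ b → 𝟙 (increasing? a b)) (λ a → Σℕ.sum λ b → 𝟙 (increasing? b a))) ⟨
    + Σℕ.sum (λ a → Σℕ.sum (λ b → 𝟙 (increasing? a b)) + Σℕ.sum (λ b → 𝟙 (increasing? b a)))
      ≡⟨ cong +_ (Σℕ.sum-cong-≗ {N} λ a → trans
           (Σℕ.sum-cong-≗ {N} (𝟙-nowhereAgree a))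
           (Σℕ.∑-distrib-+ {N} (λ b → 𝟙 (increasing? a b)) (λ b → 𝟙 (increasing? b a)))) ⟨
    + Σℕ.sum (λ a → Σℕ.sum λ b → 𝟙 (nowhereAgree? (to a) (to b)))
      ≡⟨ +-∑ {N} (λ a → Σℕ.sum λ b → 𝟙 (nowhereAgree? (to a) (to b))) ⟨
    Σℤ.sum (λ a → + Σℕ.sum λ b → 𝟙 (nowhereAgree? (to a) (to b)))
      ≡⟨ Σℤ.sum-cong-≗ {N} (λ a → ∑-nowhereAgree enumeration (to a)) ⟩
    Σℤ.sum {N} (λ _ → ξ n)
      ≡⟨ ∑-const N (ξ n) ⟩
    + N ℤ.* ξ n
      ∎
    where open ≡-Reasoning

  matrixAt : Fin N → BinaryMatrix (n * n) (n * n)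
  matrixAt = matrix ∘ to

  matrixAt-injective : ∀ {a b} → matrixAt a ≋ matrixAt b → a ≡ b
  matrixAt-injective {a} {b} eq = trans (sym (strictlyInverseʳ a))
    (trans (from-cong (matrix-injective {t = to a} {to b} eq)) (strictlyInverseʳ b))

  matrixAt-surjective : ∀ {A} → IsSPermutation n A → ∃ λ a → matrixAt a ≋ A
  matrixAt-surjective isA = let (t , t≋A) = matrix-surjective isA in
    from t , ≋-trans (matrix-cong {t = to (from t)} {t} (strictlyInverseˡ t)) t≋A

  Disjoint-resp : ∀ {A A′ B B′ : BinaryMatrix (n * n) (n * n)} → A ≋ A′ → B ≋ B′ → Disjoint A′ B′ → Disjoint A B
  Disjoint-resp A≋ B≋ disj (i , j , p , q) =
    disj (i , j , trans (sym (A≋ i j)) p , trans (sym (B≋ i j)) q)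

  pair : ∀ a b → NowhereAgree (to a) (to b) → DisjointPair n
  pair a b nowhere = record
    { A        = matrixAt a
    ; B        = matrixAt b
    ; isA      = matrix-isSPermutation (to a)
    ; isB      = matrix-isSPermutation (to b)
    ; disjoint = disjoint⇐ {t = to a} {to b} nowhere
    }

  -- A crossed match would give both `a < b` and `b < a`, so the choice of order leaves only the
  -- straight match.
  increasing-injective : ∀ {a b c d} (p : Increasing a b) (q : Increasing c d) →
                         pair a b (proj₂ p) ≈ᵤ pair c d (proj₂ q) → a ≡ c × b ≡ d
  increasing-injective _         _         (inj₁ (a≋c , b≋d)) = matrixAt-injective a≋c , matrixAt-injective b≋d
  increasing-injective (a<b , _) (c<d , _) (inj₂ (a≋d , b≋c))
    with refl ← matrixAt-injective a≋d | refl ← matrixAt-injective b≋c = contradiction c<d (<-asym a<b)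

  increasing-surjective : (p : DisjointPair n) →
                          ∃ λ a → ∃ λ b → Σ (Increasing a b) λ inc → pair a b (proj₂ inc) ≈ᵤ p
  increasing-surjective p
    with a , a≋A ← matrixAt-surjective (DisjointPair.isA p)
       | b , b≋B ← matrixAt-surjective (DisjointPair.isB p)
    with nowhere ← disjoint⇒ {t = to a} {to b} (Disjoint-resp a≋A b≋B (DisjointPair.disjoint p))
    with <-cmp a b
  ... | tri< a<b _ _  = a , b , (a<b , nowhere) , inj₁ (a≋A , b≋B)
  ... | tri> _ _ b<a  = b , a , (b<a , NowhereAgree-sym {t = to a} {to b} nowhere) , inj₂ (b≋B , a≋A)
  ... | tri≈ _ refl _ = contradiction nowhere (NowhereAgree-irrefl (to a))

  Code : Set
  Code = Σ (Fin (N * N)) IncreasingCode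

  decode : Code → DisjointPair n
  decode (x , inc) = pair (quotient N x) (remainder {N} N x) (proj₂ inc)

  decode-cong : ∀ {x y : Code} → proj₁ x ≡ proj₁ y → decode x ≈ᵤ decode y
  decode-cong refl = inj₁ (≋-refl , ≋-refl)

  decode-injective : ∀ {x y} → decode x ≈ᵤ decode y → proj₁ x ≡ proj₁ y
  decode-injective {x , p} {y , q} eq = let (a≡c , b≡d) = increasing-injective p q eq in
    trans (sym (combine-remQuot {N} N x)) (trans (cong₂ combine a≡c b≡d) (combine-remQuot {N} N y))

  -- `remQuot` of `combine a b` equals the pair only propositionally; with the equation as a premise
  -- for variable `a` and `b`, matching on `refl` makes both pairs of matrices coincide.
  decode-combine : ∀ {a b} (p : Code) (q : Increasing a b) → remQuot {N} N (proj₁ p) ≡ (a , b) →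
                   decode p ≈ᵤ pair a b (proj₂ q)
  decode-combine p q refl = inj₁ (≋-refl , ≋-refl)

  decode-surjective : ∀ p → ∃ λ (x : Code) → ∀ {y : Code} → proj₁ y ≡ proj₁ x → decode y ≈ᵤ p
  decode-surjective p = let (a , b , inc , eq) = increasing-surjective p in
    (combine a b , subst {A = Fin N × Fin N} (λ (a , b) → Increasing a b) (sym (remQuot-combine a b)) inc)
    , λ {y} y≡ → ≈ᵤ-trans {p = decode y} {pair a b (proj₂ inc)} {p}
        (decode-combine y inc (trans (cong (remQuot {N} N) y≡) (remQuot-combine a b))) eq

  decode-bijection : Bijection (setoid (Fin (N * N)) ∣ˢ IncreasingCode) (DisjointPairs n)
  decode-bijection = record
    { to        = decode
    ; cong      = λ {x} {y} → decode-cong {x} {y}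
    ; bijective = (λ {x} {y} → decode-injective {x} {y}) , decode-surjective
    }

  DisjointPairs-cardinality : HasCardinality (DisjointPairs n) #increasing
  DisjointPairs-cardinality =
    Bij.trans (Inv.Inverse⇒Bijection (Card-filter increasingCode?)) decode-bijection

corollary1 : ∀ (n : ℕ) .{{_ : NonZero n}} →
    ∃[ η ] (HasCardinality (DisjointPairs n) η
    × (+ η) / 1 ≡ ((+ ((n !) ^ (2 * n))) / 2) ℚ.* (ξ n / 1))
corollary1 n = #increasing arrays , DisjointPairs-cardinality arrays ,
  half-/ (+ ((n !) ^ (2 * n))) (ξ n) (#increasing arrays) (#increasing-double arrays)
  where arrays = Card-PermutationArrays n
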